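{- Let $k\geq 1$ be an integer. Every graph $G$ of treewidth at most $k$ satisfies $$\overline{\mathrm{cr}}(G)\leq k\cdot(k+2)\cdot\Delta(G)\cdot\|G\|,$$ where $\overline{\mathrm{cr}}(G)$ is the rectilinear crossing number, $\Delta(G)$ the maximum degree and $\|G\|$ the number of edges of $G$.
   Context: Graphs are undirected, simple and finite. A rectilinear drawing of $G$ represents the vertices by distinct points of the plane in general position (no three on a line, and no three segments between pairs of these points meet in one point unless all three share a common endpoint) and each edge by the straight line-segment between its endpoints. A crossing is a point of intersection of two edges other than a common endpoint. The rectilinear crossing number $\overline{\mathrm{cr}}(G)$ is the minimum number of crossings in any rectilinear drawing of $G$. Treewidth is the usual one: the minimum, over tree decompositions, of the maximum bag size minus $1$. -}

module Defs where

open import Level using (0ℓ)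
open import Data.Nat as ℕ using (ℕ; _∸_; _⊔_)
import Data.Nat.Properties as ℕₚ
open import Data.Rational as ℚ using (ℚ; 0ℚ; 1ℚ; ½)
import Data.Rational.Properties as ℚₚ
open import Data.Rational.Solver using (module +-*-Solver)
open import Data.Fin as Fin using (Fin)
import Data.Fin.Properties as Finₚ
open import Data.Fin.Subset using (Subset; ∣_∣) renaming (_∈_ to _∈ₛ_)
open import Data.List using (List; []; _∷_; _++_; length; map; filter; allFin; cartesianProduct)
open import Data.List.Extrema.Nat using (max)
open import Data.List.Relation.Unary.Linked using (Linked)
open import Data.List.Relation.Unary.Unique.Propositional using (Unique)
import Data.List.Relation.Unary.Unique.Setoid as UniqueSetoid
import Data.List.Membership.Setoid as MembershipSetoid
open import Data.Product using (Σ; ∃; ∃₂; _×_; _,_; proj₁; proj₂)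
open import Data.Product.Relation.Binary.Pointwise.NonDependent using (×-setoid)
open import Data.Sum using (_⊎_)
open import Function.Base using (_∘_)
open import Function.Bundles using (_⇔_; mk⇔)
open import Relation.Nullary using (¬_; Dec)
open import Relation.Nullary.Decidable using (_×-dec_)
open import Relation.Binary.Core using (Rel)
open import Relation.Binary.Bundles using (Setoid)
open import Relation.Binary.Definitions using (Decidable; Symmetric; Irreflexive)
open import Relation.Binary.Construct.Closure.ReflexiveTransitive using (Star)
open import Relation.Binary.PropositionalEquality
  using (_≡_; _≢_; refl; sym; trans; cong; subst)

IsMinimum : ∀ {ℓ} → (ℕ → Set ℓ) → ℕ → Set ℓ
IsMinimum P m = P m × (∀ m′ → P m′ → m ℕ.≤ m′)

-- min { m | P m } ≤ b.  The minimum of an inhabited set need not be computable,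
-- so it is not a function of P; minAtMost⇔ justifies the definition.
MinAtMost : ∀ {ℓ} → (ℕ → Set ℓ) → ℕ → Set ℓ
MinAtMost P b = ∃ λ m → P m × m ℕ.≤ b

minAtMost⇔ : ∀ {ℓ} {P : ℕ → Set ℓ} {m b} → IsMinimum P m → MinAtMost P b ⇔ (m ℕ.≤ b)
minAtMost⇔ (Pm , least) =
  mk⇔ (λ (m′ , Pm′ , m′≤b) → ℕₚ.≤-trans (least m′ Pm′) m′≤b)
      (λ m≤b → _ , Pm , m≤b)

Eventually : (ℕ → Set) → Set
Eventually P = ∃ λ N → ∀ n → N ℕ.≤ n → P n

Cauchy : (ℕ → ℚ) → Set
Cauchy x = ∀ ε → 0ℚ ℚ.< ε →
  ∃ λ N → ∀ m n → N ℕ.≤ m → N ℕ.≤ n → ℚ.∣ x m ℚ.- x n ∣ ℚ.≤ ε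

-- Real numbers are Cauchy sequences of rationals, with equality _≈_.
record ℝ : Set where
  constructor mkℝ
  field
    seq    : ℕ → ℚ
    cauchy : Cauchy seq

open ℝ public

infix 4 _≈_ _≤ᵣ_

_≈_ : Rel ℝ 0ℓ
x ≈ y = ∀ ε → 0ℚ ℚ.< ε → Eventually λ n → ℚ.∣ seq x n ℚ.- seq y n ∣ ℚ.≤ ε

_≤ᵣ_ : Rel ℝ 0ℓ
x ≤ᵣ y = ∀ ε → 0ℚ ℚ.< ε → Eventually λ n → seq x n ℚ.≤ seq y n ℚ.+ ε

half : ∀ ε → ½ ℚ.* ε ℚ.+ ½ ℚ.* ε ≡ ε
half ε = trans (sym (ℚₚ.*-distribʳ-+ ε ½ ½)) (ℚₚ.*-identityˡ ε)

0<* : ∀ {p q} → 0ℚ ℚ.< p → 0ℚ ℚ.< q → 0ℚ ℚ.< p ℚ.* q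
0<* {p} {q} 0<p 0<q =
  subst (ℚ._< p ℚ.* q) (ℚₚ.*-zeroʳ p) (ℚₚ.*-monoʳ-<-pos p {{ℚ.positive 0<p}} 0<q)

0<½ : ∀ {ε} → 0ℚ ℚ.< ε → 0ℚ ℚ.< ½ ℚ.* ε
0<½ = 0<* (ℚₚ.positive⁻¹ ½)

dist-comm : ∀ p q → ℚ.∣ p ℚ.- q ∣ ≡ ℚ.∣ q ℚ.- p ∣
dist-comm p q = trans (cong ℚ.∣_∣ (flip p q)) (ℚₚ.∣-p∣≡∣p∣ (q ℚ.- p))
  where
  open +-*-Solver
  flip : ∀ p q → p ℚ.- q ≡ ℚ.- (q ℚ.- p)
  flip = solve 2 (λ a b → a :- b := :- (b :- a)) refl

triangle : ∀ {p q ε} r → p ℚ.+ q ≡ r →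
  ℚ.∣ p ∣ ℚ.≤ ½ ℚ.* ε → ℚ.∣ q ∣ ℚ.≤ ½ ℚ.* ε → ℚ.∣ r ∣ ℚ.≤ ε
triangle {p} {q} {ε} _ refl hp hq =
  ℚₚ.≤-trans (ℚₚ.∣p+q∣≤∣p∣+∣q∣ p q)
    (ℚₚ.≤-trans (ℚₚ.+-mono-≤ hp hq) (ℚₚ.≤-reflexive (half ε)))

⊔ˡ : ∀ {a b n} → a ⊔ b ℕ.≤ n → a ℕ.≤ n
⊔ˡ = ℕₚ.m⊔n≤o⇒m≤o _ _

⊔ʳ : ∀ {a b n} → a ⊔ b ℕ.≤ n → b ℕ.≤ n
⊔ʳ = ℕₚ.m⊔n≤o⇒n≤o _ _

bounded : ∀ x → ∃ λ K → 0ℚ ℚ.< K × Eventually λ n → ℚ.∣ seq x n ∣ ℚ.≤ K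
bounded x = K , 0<K , N , bound
  where
  N = proj₁ (cauchy x 1ℚ (ℚₚ.positive⁻¹ 1ℚ))
  K = 1ℚ ℚ.+ ℚ.∣ seq x N ∣
  0<K : 0ℚ ℚ.< K
  0<K = ℚₚ.+-mono-<-≤ (ℚₚ.positive⁻¹ 1ℚ) (ℚₚ.0≤∣p∣ (seq x N))
  open +-*-Solver
  split : ∀ p q → (p ℚ.- q) ℚ.+ q ≡ p
  split = solve 2 (λ a b → (a :- b) :+ b := a) refl
  bound : ∀ n → N ℕ.≤ n → ℚ.∣ seq x n ∣ ℚ.≤ K
  bound n N≤n = subst (λ z → ℚ.∣ z ∣ ℚ.≤ K) (split (seq x n) (seq x N))
    (ℚₚ.≤-trans (ℚₚ.∣p+q∣≤∣p∣+∣q∣ (seq x n ℚ.- seq x N) (seq x N))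
      (ℚₚ.+-mono-≤ (proj₂ (cauchy x 1ℚ (ℚₚ.positive⁻¹ 1ℚ)) n N N≤n ℕₚ.≤-refl)
                   ℚₚ.≤-refl))

fromℚ : ℚ → ℝ
fromℚ q = mkℝ (λ _ → q) λ ε 0<ε → 0 , λ _ _ _ _ →
  subst (λ z → ℚ.∣ z ∣ ℚ.≤ ε) (sym (ℚₚ.+-inverseʳ q)) (ℚₚ.<⇒≤ 0<ε)

0ᵣ 1ᵣ : ℝ
0ᵣ = fromℚ 0ℚ
1ᵣ = fromℚ 1ℚ

infixl 6 _+ᵣ_ _-ᵣ_
infixl 7 _*ᵣ_
infix  8 -ᵣ_

_+ᵣ_ : ℝ → ℝ → ℝ
x +ᵣ y = mkℝ (λ n → seq x n ℚ.+ seq y n) λ ε 0<ε →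
  let (M , hx) = cauchy x (½ ℚ.* ε) (0<½ 0<ε)
      (N , hy) = cauchy y (½ ℚ.* ε) (0<½ 0<ε)
  in M ⊔ N , λ m n m≥ n≥ →
       triangle _ (rearrange (seq x m) (seq x n) (seq y m) (seq y n))
         (hx m n (⊔ˡ m≥) (⊔ˡ n≥)) (hy m n (⊔ʳ {M} m≥) (⊔ʳ {M} n≥))
  where
  open +-*-Solver
  rearrange : ∀ a b c d → (a ℚ.- b) ℚ.+ (c ℚ.- d) ≡ (a ℚ.+ c) ℚ.- (b ℚ.+ d)
  rearrange = solve 4 (λ a b c d → (a :- b) :+ (c :- d) := (a :+ c) :- (b :+ d)) refl

-ᵣ_ : ℝ → ℝ
-ᵣ x = mkℝ (λ n → ℚ.- seq x n) λ ε 0<ε →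
  let (N , h) = cauchy x ε 0<ε
  in N , λ m n m≥ n≥ →
       subst (λ z → ℚ.∣ z ∣ ℚ.≤ ε) (rearrange (seq x m) (seq x n)) (h n m n≥ m≥)
  where
  open +-*-Solver
  rearrange : ∀ a b → b ℚ.- a ≡ ℚ.- a ℚ.- ℚ.- b
  rearrange = solve 2 (λ a b → b :- a := :- a :- :- b) refl

_-ᵣ_ : ℝ → ℝ → ℝ
x -ᵣ y = x +ᵣ (-ᵣ y)

_*ᵣ_ : ℝ → ℝ → ℝ
x *ᵣ y = mkℝ (λ n → seq x n ℚ.* seq y n) prod
  where
  Kx = proj₁ (bounded x)
  Ky = proj₁ (bounded y)
  Bx = proj₁ (proj₂ (proj₂ (bounded x)))
  By = proj₁ (proj₂ (proj₂ (bounded y)))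
  hBx = proj₂ (proj₂ (proj₂ (bounded x)))
  hBy = proj₂ (proj₂ (proj₂ (bounded y)))
  K = Kx ℚ.+ Ky
  instance
    posK : ℚ.Positive K
    posK = ℚ.positive (ℚₚ.+-mono-< (proj₁ (proj₂ (bounded x))) (proj₁ (proj₂ (bounded y))))
    nonZeroK : ℚ.NonZero K
    nonZeroK = ℚₚ.pos⇒nonZero K
  open +-*-Solver
  rearrange : ∀ a b c d → a ℚ.* (c ℚ.- d) ℚ.+ d ℚ.* (a ℚ.- b) ≡ a ℚ.* c ℚ.- b ℚ.* d
  rearrange = solve 4 (λ a b c d → a :* (c :- d) :+ d :* (a :- b) := a :* c :- b :* d) refl

  abs-* : ∀ {p q a b} → ℚ.∣ p ∣ ℚ.≤ a → ℚ.∣ q ∣ ℚ.≤ b → 0ℚ ℚ.≤ a →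
    ℚ.∣ p ℚ.* q ∣ ℚ.≤ a ℚ.* b
  abs-* {p} {q} {a} {b} hp hq 0≤a = subst (ℚ._≤ a ℚ.* b) (sym (ℚₚ.∣p*q∣≡∣p∣*∣q∣ p q))
    (ℚₚ.≤-trans
      (ℚₚ.*-monoʳ-≤-nonNeg ℚ.∣ q ∣ {{ℚ.nonNegative (ℚₚ.0≤∣p∣ q)}} hp)
      (ℚₚ.*-monoˡ-≤-nonNeg a {{ℚ.nonNegative 0≤a}} hq))

  prod : Cauchy (λ n → seq x n ℚ.* seq y n)
  prod ε 0<ε = (Bx ⊔ By) ⊔ (M ⊔ N) , close
    where
    δ = ε ℚ.* ℚ.1/ K
    0<δ : 0ℚ ℚ.< δ
    0<δ = 0<* 0<ε (ℚₚ.positive⁻¹ (ℚ.1/ K) {{ℚₚ.1/pos⇒pos K}})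
    Kδ≡ε : Kx ℚ.* δ ℚ.+ Ky ℚ.* δ ≡ ε
    Kδ≡ε = trans (sym (ℚₚ.*-distribʳ-+ δ Kx Ky))
      (trans (ℚₚ.*-comm K δ)
      (trans (ℚₚ.*-assoc ε (ℚ.1/ K) K)
      (trans (cong (ε ℚ.*_) (ℚₚ.*-inverseˡ K)) (ℚₚ.*-identityʳ ε))))
    M = proj₁ (cauchy x δ 0<δ)
    N = proj₁ (cauchy y δ 0<δ)
    close : ∀ m n → (Bx ⊔ By) ⊔ (M ⊔ N) ℕ.≤ m → (Bx ⊔ By) ⊔ (M ⊔ N) ℕ.≤ n →
      ℚ.∣ seq x m ℚ.* seq y m ℚ.- seq x n ℚ.* seq y n ∣ ℚ.≤ ε
    close m n m≥ n≥ =
      subst (λ z → ℚ.∣ z ∣ ℚ.≤ ε) (rearrange (seq x m) (seq x n) (seq y m) (seq y n))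
        (ℚₚ.≤-trans (ℚₚ.∣p+q∣≤∣p∣+∣q∣ (seq x m ℚ.* (seq y m ℚ.- seq y n))
                                        (seq y n ℚ.* (seq x m ℚ.- seq x n)))
        (ℚₚ.≤-trans (ℚₚ.+-mono-≤
            (abs-* (hBx m (⊔ˡ (⊔ˡ m≥)))
                   (proj₂ (cauchy y δ 0<δ) m n (⊔ʳ {M} (⊔ʳ {Bx ⊔ By} m≥)) (⊔ʳ {M} (⊔ʳ {Bx ⊔ By} n≥)))
                   (ℚₚ.<⇒≤ (proj₁ (proj₂ (bounded x)))))
            (abs-* (hBy n (⊔ʳ {Bx} (⊔ˡ n≥)))
                   (proj₂ (cauchy x δ 0<δ) m n (⊔ˡ (⊔ʳ {Bx ⊔ By} m≥)) (⊔ˡ (⊔ʳ {Bx ⊔ By} n≥)))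
                   (ℚₚ.<⇒≤ (proj₁ (proj₂ (bounded y))))))
          (ℚₚ.≤-reflexive Kδ≡ε)))

≈-refl : ∀ {x} → x ≈ x
≈-refl {x} ε 0<ε = 0 , λ n _ →
  subst (λ z → ℚ.∣ z ∣ ℚ.≤ ε) (sym (ℚₚ.+-inverseʳ (seq x n))) (ℚₚ.<⇒≤ 0<ε)

≈-sym : ∀ {x y} → x ≈ y → y ≈ x
≈-sym {x} {y} h ε 0<ε = let (N , k) = h ε 0<ε in
  N , λ n n≥ → subst (ℚ._≤ ε) (dist-comm (seq x n) (seq y n)) (k n n≥)

≈-trans : ∀ {x y z} → x ≈ y → y ≈ z → x ≈ z
≈-trans {x} {y} {z} h k ε 0<ε =
  let (M , h′) = h (½ ℚ.* ε) (0<½ 0<ε)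
      (N , k′) = k (½ ℚ.* ε) (0<½ 0<ε)
  in M ⊔ N , λ n n≥ → triangle _ (telescope (seq x n) (seq y n) (seq z n))
       (h′ n (⊔ˡ n≥)) (k′ n (⊔ʳ {M} n≥))
  where
  open +-*-Solver
  telescope : ∀ a b c → (a ℚ.- b) ℚ.+ (b ℚ.- c) ≡ a ℚ.- c
  telescope = solve 3 (λ a b c → (a :- b) :+ (b :- c) := a :- c) refl

ℝ-setoid : Setoid 0ℓ 0ℓ
ℝ-setoid = record
  { Carrier       = ℝ
  ; _≈_           = _≈_
  ; isEquivalence = record
    { refl  = λ {x} → ≈-refl {x}
    ; sym   = λ {x} {y} → ≈-sym {x} {y}
    ; trans = λ {x} {y} {z} → ≈-trans {x} {y} {z}
    }
  }

planeSetoid : Setoid 0ℓ 0ℓ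
planeSetoid = ×-setoid ℝ-setoid ℝ-setoid

Point : Set
Point = ℝ × ℝ

infix 4 _≈ₚ_

_≈ₚ_ : Rel Point 0ℓ
_≈ₚ_ = Setoid._≈_ planeSetoid

OnSegment : Point → Point → Point → Set
OnSegment (ax , ay) (bx , by) P = ∃ λ t → 0ᵣ ≤ᵣ t × t ≤ᵣ 1ᵣ ×
  P ≈ₚ ((1ᵣ -ᵣ t) *ᵣ ax +ᵣ t *ᵣ bx , (1ᵣ -ᵣ t) *ᵣ ay +ᵣ t *ᵣ by)

record Line : Set where
  field
    a b c   : ℝ
    nonzero : ¬ (a ≈ 0ᵣ × b ≈ 0ᵣ)

OnLine : Line → Point → Set
OnLine ℓ (x , y) = a *ᵣ x +ᵣ b *ᵣ y ≈ c
  where open Line ℓ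

Collinear : Point → Point → Point → Set
Collinear P Q R = ∃ λ ℓ → OnLine ℓ P × OnLine ℓ Q × OnLine ℓ R

record Graph (n : ℕ) : Set₁ where
  infix 4 _~_ _~?_
  field
    _~_    : Rel (Fin n) 0ℓ
    _~?_   : Decidable _~_
    symm   : Symmetric _~_
    irrefl : Irreflexive _≡_ _~_

-- The unordered pair {u , v} of distinct vertices is represented by the
-- pair (u , v) with u < v.
Pair : ℕ → Set
Pair n = Fin n × Fin n

Ordered : ∀ {n} → Pair n → Set
Ordered (u , v) = u Fin.< v

_∈ₑ_ : ∀ {n} → Fin n → Pair n → Set
w ∈ₑ (u , v) = w ≡ u ⊎ w ≡ v

module _ {n} (G : Graph n) where
  open Graph G

  IsEdge : Pair n → Set
  IsEdge e@(u , v) = Ordered e × u ~ v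

  isEdge? : ∀ e → Dec (IsEdge e)
  isEdge? (u , v) = (u Finₚ.<? v) ×-dec (u ~? v)

  degree : Fin n → ℕ
  degree v = length (filter (v ~?_) (allFin n))

  Δ : ℕ
  Δ = max 0 (map degree (allFin n))

  Connected : Set
  Connected = ∀ u v → Star _~_ u v

  -- x ∷ xs lists the vertices of a cycle, of which there are at least three.
  IsCycle : Fin n → List (Fin n) → Set
  IsCycle x xs = 2 ℕ.≤ length xs × Unique (x ∷ xs) × Linked _~_ (x ∷ xs ++ x ∷ [])

  Acyclic : Set
  Acyclic = ∀ x xs → ¬ IsCycle x xs

  IsTree : Set
  IsTree = 1 ℕ.≤ n × Connected × Acyclic

‖_‖ : ∀ {n} → Graph n → ℕ
‖_‖ {n} G = length (filter (isEdge? G) (cartesianProduct (allFin n) (allFin n)))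

record TreeDecomposition {n} (G : Graph n) : Set₁ where
  private module G = Graph G
  field
    size   : ℕ
    T      : Graph size
    isTree : IsTree T
    bag    : Fin size → Subset n
  private module T = Graph T
  field
    vertex-covered : ∀ v → ∃ λ s → v ∈ₛ bag s
    edge-covered   : ∀ u v → u G.~ v → ∃ λ s → u ∈ₛ bag s × v ∈ₛ bag s
    connected      : ∀ v s t → v ∈ₛ bag s → v ∈ₛ bag t →
      Star (λ p q → p T.~ q × v ∈ₛ bag p × v ∈ₛ bag q) s t

  width : ℕ
  width = max 0 (map (∣_∣ ∘ bag) (allFin size)) ∸ 1

HasDecompositionOfWidth : ∀ {n} → Graph n → ℕ → Set₁
HasDecompositionOfWidth G w = Σ (TreeDecomposition G) λ D → TreeDecomposition.width D ≡ w

TreewidthAtMost : ∀ {n} → Graph n → ℕ → Set₁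
TreewidthAtMost G = MinAtMost (HasDecompositionOfWidth G)

module _ {n} (pos : Fin n → Point) where

  OnPair : Pair n → Point → Set
  OnPair (u , v) = OnSegment (pos u) (pos v)

  record GeneralPosition : Set where
    field
      distinct : ∀ u v → u ≢ v → ¬ (pos u ≈ₚ pos v)
      no-three-collinear : ∀ u v w → u ≢ v → v ≢ w → u ≢ w →
        ¬ Collinear (pos u) (pos v) (pos w)
      no-three-concurrent : ∀ e f g → Ordered e → Ordered f → Ordered g →
        e ≢ f → f ≢ g → e ≢ g →
        ∀ P → OnPair e P → OnPair f P → OnPair g P →
        ∃ λ v → v ∈ₑ e × v ∈ₑ f × v ∈ₑ g

record RectilinearDrawing {n} (G : Graph n) : Set where
  field
    pos             : Fin n → Point
    generalPosition : GeneralPosition pos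

  IsCrossing : Point → Set
  IsCrossing P = ∃₂ λ e f → IsEdge G e × IsEdge G f × e ≢ f ×
    OnPair pos e P × OnPair pos f P ×
    ¬ (∃ λ v → v ∈ₑ e × v ∈ₑ f × P ≈ₚ pos v)

  -- Ps lists the crossing points, each once up to equality of points.
  HasCrossings : ℕ → Set
  HasCrossings m = ∃ λ Ps → UniqueSetoid.Unique planeSetoid Ps ×
    (∀ P → IsCrossing P ⇔ (P ∈ Ps)) × length Ps ≡ m
    where open MembershipSetoid planeSetoid using (_∈_)

HasDrawingWithCrossings : ∀ {n} → Graph n → ℕ → Set
HasDrawingWithCrossings G m = Σ (RectilinearDrawing G) λ D → RectilinearDrawing.HasCrossings D m

RectilinearCrossingNumberAtMost : ∀ {n} → Graph n → ℕ → Set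
RectilinearCrossingNumberAtMost G = MinAtMost (HasDrawingWithCrossings G)

{-# OPTIONS --safe #-}
-- Place the vertices on the parabola y = x² in an order read off the tree decomposition: order the
-- nodes of the tree depth first, and rank each vertex by the first node whose bag contains it.  Since
-- the points are in convex position, edges ab and cd with a < c < b < d are the only ones to cross,
-- and then the first node t of c lies, in the tree, between the first nodes of a and b, both of which
-- are in the subtree of a; so a is in the bag of t.  Hence each edge cd is crossed in this way by at
-- most (k + 1) Δ edges ab, and k + 1 ≤ k (k + 2).  Doubly exponential abscissae 2, 4, 16, 256, …
-- exclude three concurrent chords: the determinant of their lines is then positive.
module Submission where

open import Defs
open import Data.Nat as ℕ using (ℕ; zero; suc; _+_; _*_; _≤_; _<_; _⊔_; z≤n; s≤s)
import Data.Nat.Properties as ℕₚ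
open import Data.Rational as ℚ using (ℚ; 0ℚ; 1ℚ; ½)
import Data.Rational.Properties as ℚₚ
open import Data.Rational.Solver using (module +-*-Solver)
open import Data.Product using (Σ; ∃; _×_; _,_; proj₁; proj₂; swap)
open import Data.Sum using (_⊎_; inj₁; inj₂; [_,_]′)
open import Data.Empty using (⊥; ⊥-elim)
open import Function.Base using (_∘_; id)
open import Relation.Nullary using (¬_; Dec; yes; no)
open import Relation.Binary.Definitions using (tri<; tri≈; tri>)
open import Relation.Binary.PropositionalEquality
  using (_≡_; _≢_; refl; sym; trans; cong; cong₂; subst; subst₂; setoid)
open import Data.Fin as Fin using (Fin; toℕ)
import Data.Fin.Properties as Finₚ
open import Data.Fin.Subset as Subset using (Subset; ∣_∣) renaming (_∈_ to _∈ₛ_)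
import Data.Fin.Subset.Properties as Subsetₚ
open import Data.Vec using ([]; _∷_)
import Data.Vec as Vec
open import Data.List
  using (List; []; _∷_; _++_; length; map; filter; concatMap; deduplicate; allFin; cartesianProduct)
import Data.List.Properties as Listₚ
open import Data.List.Extrema.Nat using (argmin; argmin-all; f[argmin]≤f[xs]; max; xs≤max)
open import Data.List.Membership.Propositional using (_∈_; _∉_; find; lose)
open import Data.List.Membership.Propositional.Properties
  using (∈-allFin; ∈-map⁺; ∈-map⁻; ∈-filter⁺; ∈-filter⁻; ∈-concatMap⁺; ∈-concatMap⁻;
         ∈-deduplicate⁺; ∈-deduplicate⁻; ∈-cartesianProduct⁺)
import Data.List.Membership.DecPropositional as DecMembership
open import Data.List.Relation.Unary.All as All using (All; []; _∷_)
import Data.List.Relation.Unary.All.Properties as Allₚ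
open import Data.List.Relation.Unary.Any using (here; there)
import Data.List.Relation.Unary.Any.Properties as Anyₚ
open import Data.List.Relation.Unary.AllPairs using ([]; _∷_)
open import Data.List.Relation.Unary.Linked using (Linked; [-]; _∷_)
open import Data.List.Relation.Unary.Unique.Propositional using (Unique)
import Data.List.Relation.Unary.Unique.DecPropositional.Properties as UniqueDecₚ
import Data.List.Relation.Unary.Unique.Setoid.Properties as UniqueSetoidₚ
import Data.List.Relation.Unary.Unique.Setoid as UniqueSetoid
import Data.List.Membership.Setoid as MembershipSetoid
open import Data.Product.Properties using (≡-dec)
open import Function.Bundles using (mk⇔)
open import Relation.Nullary.Decidable using (_×-dec_)
open import Relation.Unary using (Decidable)
open import Relation.Binary.Construct.Closure.ReflexiveTransitive using (Star; _◅_; _◅◅_) renaming (ε to ε⋆)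

-- Limits of rational sequences

-- The coordinates of a point are Cauchy sequences, whose signs cannot be decided. Every case
-- distinction is therefore made on ranks or on rational numbers, and a point `P` enters only
-- through sequences tending to 0, which are combined with rational coefficients. Crossing points
-- turn out to be rational, so they can be listed and compared. General position concerns all pairs
-- of vertices, not only the edges. Concurrency must hence be excluded by the choice of the
-- abscissae alone, whatever the graph. Ancestors and rooted subtrees never appear. The one fact
-- about depth-first orders that is used, `Separating`, speaks of arbitrary connected sets of nodes;
-- in this form it is inherited when a leaf is hung onto the tree, because contracting the leaf maps
-- connected sets to connected sets. Each crossing is charged to the one of its two edges that
-- starts later, so no factor 2 is lost.

0≤* : ∀ {p q} → 0ℚ ℚ.≤ p → 0ℚ ℚ.≤ q → 0ℚ ℚ.≤ p ℚ.* q
0≤* {p} {q} 0≤p 0≤q = ℚₚ.nonNegative⁻¹ (p ℚ.* q)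
  {{ℚₚ.nonNeg*nonNeg⇒nonNeg p {{ℚ.nonNegative 0≤p}} q {{ℚ.nonNegative 0≤q}}}}

0≤+ : ∀ {p q} → 0ℚ ℚ.≤ p → 0ℚ ℚ.≤ q → 0ℚ ℚ.≤ p ℚ.+ q
0≤+ = ℚₚ.+-mono-≤

0<+ : ∀ {p q} → 0ℚ ℚ.≤ p → 0ℚ ℚ.< q → 0ℚ ℚ.< p ℚ.+ q
0<+ = ℚₚ.+-mono-≤-<

p<q⇒0<q-p : ∀ {p q} → p ℚ.< q → 0ℚ ℚ.< q ℚ.- p
p<q⇒0<q-p {p} {q} p<q = subst (ℚ._< q ℚ.- p) (ℚₚ.+-inverseʳ p) (ℚₚ.+-monoˡ-< (ℚ.- p) p<q)

p≤q⇒0≤q-p : ∀ {p q} → p ℚ.≤ q → 0ℚ ℚ.≤ q ℚ.- p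
p≤q⇒0≤q-p {p} {q} p≤q = subst (ℚ._≤ q ℚ.- p) (ℚₚ.+-inverseʳ p) (ℚₚ.+-monoˡ-≤ (ℚ.- p) p≤q)

0≤q-p⇒p≤q : ∀ {p q} → 0ℚ ℚ.≤ q ℚ.- p → p ℚ.≤ q
0≤q-p⇒p≤q {p} {q} 0≤q-p = subst₂ ℚ._≤_ (ℚₚ.+-identityˡ p) (cancel p q) (ℚₚ.+-monoˡ-≤ p 0≤q-p)
  where
  open +-*-Solver
  cancel : ∀ p q → q ℚ.- p ℚ.+ p ≡ q
  cancel = solve 2 (λ p q → q :- p :+ p := q) refl

∣p∣≤q⇒0≤p+q : ∀ {p q} → ℚ.∣ p ∣ ℚ.≤ q → 0ℚ ℚ.≤ p ℚ.+ q
∣p∣≤q⇒0≤p+q {p} {q} ∣p∣≤q =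
  ℚₚ.≤-trans ([ nonneg , nonpos ]′ (ℚₚ.∣p∣≡p∨∣p∣≡-p p)) (ℚₚ.+-monoʳ-≤ p ∣p∣≤q)
  where
  nonneg : ℚ.∣ p ∣ ≡ p → 0ℚ ℚ.≤ p ℚ.+ ℚ.∣ p ∣
  nonneg eq = 0≤+ (ℚₚ.∣p∣≡p⇒0≤p eq) (ℚₚ.0≤∣p∣ p)
  nonpos : ℚ.∣ p ∣ ≡ ℚ.- p → 0ℚ ℚ.≤ p ℚ.+ ℚ.∣ p ∣
  nonpos eq = ℚₚ.≤-reflexive (sym (trans (cong (p ℚ.+_) eq) (ℚₚ.+-inverseʳ p)))

0≤±p+q⇒∣p∣≤q : ∀ {p q} → 0ℚ ℚ.≤ p ℚ.+ q → 0ℚ ℚ.≤ ℚ.- p ℚ.+ q → ℚ.∣ p ∣ ℚ.≤ q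
0≤±p+q⇒∣p∣≤q {p} {q} h k =
  0≤q-p⇒p≤q ([ nonneg , nonpos ]′ (ℚₚ.∣p∣≡p∨∣p∣≡-p p))
  where
  open +-*-Solver
  e₁ : ∀ p q → ℚ.- p ℚ.+ q ≡ q ℚ.- p
  e₁ = solve 2 (λ p q → :- p :+ q := q :- p) refl
  e₂ : ∀ p q → p ℚ.+ q ≡ q ℚ.- ℚ.- p
  e₂ = solve 2 (λ p q → p :+ q := q :- :- p) refl
  nonneg : ℚ.∣ p ∣ ≡ p → 0ℚ ℚ.≤ q ℚ.- ℚ.∣ p ∣
  nonneg eq = subst (0ℚ ℚ.≤_) (trans (e₁ p q) (cong (λ z → q ℚ.- z) (sym eq))) k
  nonpos : ℚ.∣ p ∣ ≡ ℚ.- p → 0ℚ ℚ.≤ q ℚ.- ℚ.∣ p ∣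
  nonpos eq = subst (0ℚ ℚ.≤_) (trans (e₂ p q) (cong (λ z → q ℚ.- z) (sym eq))) h

-- The lower limit of `f` is at least 0. A one-sided condition lets inequalities such as `0ᵣ ≤ᵣ t`
-- be added to relations that hold in the limit.
record Limit≥0 (f : ℕ → ℚ) : Set where
  constructor limit≥0
  field
    eventually : ∀ ε → 0ℚ ℚ.< ε → Eventually λ n → 0ℚ ℚ.≤ f n ℚ.+ ε

open Limit≥0

-- Convergence to 0 as two one-sided bounds instead of an absolute value: sums and multiples reduce
-- to those of `Limit≥0`, and one half can be used alone.
Null : (ℕ → ℚ) → Set
Null f = Limit≥0 f × Limit≥0 (λ n → ℚ.- f n)

limit≥0-cong : ∀ {f g} → (∀ n → f n ≡ g n) → Limit≥0 f → Limit≥0 g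
limit≥0-cong eq F = limit≥0 λ ε 0<ε → proj₁ (eventually F ε 0<ε) ,
  λ n n≥ → subst (λ z → 0ℚ ℚ.≤ z ℚ.+ ε) (eq n) (proj₂ (eventually F ε 0<ε) n n≥)

limit≥0-+ : ∀ {f g} → Limit≥0 f → Limit≥0 g → Limit≥0 (λ n → f n ℚ.+ g n)
limit≥0-+ {f} {g} (limit≥0 F) (limit≥0 G) = limit≥0 λ ε 0<ε →
  let (M , h) = F (½ ℚ.* ε) (0<½ 0<ε)
      (N , k) = G (½ ℚ.* ε) (0<½ 0<ε)
  in M ⊔ N , λ n n≥ →
    subst (0ℚ ℚ.≤_) (trans (rearrange (f n) (g n) (½ ℚ.* ε)) (cong (f n ℚ.+ g n ℚ.+_) (half ε)))
      (0≤+ (h n (⊔ˡ n≥)) (k n (⊔ʳ {M} n≥)))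
  where
  open +-*-Solver
  rearrange : ∀ a b h → (a ℚ.+ h) ℚ.+ (b ℚ.+ h) ≡ (a ℚ.+ b) ℚ.+ (h ℚ.+ h)
  rearrange = solve 3 (λ a b h → (a :+ h) :+ (b :+ h) := (a :+ b) :+ (h :+ h)) refl

limit≥0-* : ∀ {f} c → 0ℚ ℚ.≤ c → Limit≥0 f → Limit≥0 (λ n → c ℚ.* f n)
limit≥0-* {f} c 0≤c (limit≥0 F) = limit≥0 scaled
  where
  instance
    pos : ℚ.Positive (c ℚ.+ 1ℚ)
    pos = ℚ.positive (0<+ 0≤c (ℚₚ.positive⁻¹ 1ℚ))
    nz : ℚ.NonZero (c ℚ.+ 1ℚ)
    nz = ℚₚ.pos⇒nonZero (c ℚ.+ 1ℚ)
  open +-*-Solver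
  rearrange : ∀ c x d → c ℚ.* (x ℚ.+ d) ℚ.+ d ≡ c ℚ.* x ℚ.+ (c ℚ.+ 1ℚ) ℚ.* d
  rearrange = solve 3 (λ c x d → c :* (x :+ d) :+ d := c :* x :+ (c :+ con 1ℚ) :* d) refl
  scaled : ∀ ε → 0ℚ ℚ.< ε → Eventually λ n → 0ℚ ℚ.≤ c ℚ.* f n ℚ.+ ε
  scaled ε 0<ε = proj₁ (F δ 0<δ) , λ n n≥ →
    subst (0ℚ ℚ.≤_) (trans (rearrange c (f n) δ) (cong (c ℚ.* f n ℚ.+_) δ≡))
      (0≤+ (0≤* 0≤c (proj₂ (F δ 0<δ) n n≥)) (ℚₚ.<⇒≤ 0<δ))
    where
    -- Dividing by `c + 1` and not by `c` allows `c = 0`; the spare `δ` completes `c * δ + δ = ε`.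
    δ = ℚ.1/ (c ℚ.+ 1ℚ) ℚ.* ε
    0<δ : 0ℚ ℚ.< δ
    0<δ = 0<* (ℚₚ.positive⁻¹ (ℚ.1/ (c ℚ.+ 1ℚ)) {{ℚₚ.1/pos⇒pos (c ℚ.+ 1ℚ)}}) 0<ε
    δ≡ : (c ℚ.+ 1ℚ) ℚ.* δ ≡ ε
    δ≡ = trans (sym (ℚₚ.*-assoc (c ℚ.+ 1ℚ) (ℚ.1/ (c ℚ.+ 1ℚ)) ε))
      (trans (cong (ℚ._* ε) (ℚₚ.*-inverseʳ (c ℚ.+ 1ℚ))) (ℚₚ.*-identityˡ ε))

limit≥0-const : ∀ {c} → Limit≥0 (λ _ → c) → 0ℚ ℚ.≤ c
limit≥0-const {c} (limit≥0 F) = ℚₚ.≮⇒≥ λ c<0 →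
  let 0<-c = subst (0ℚ ℚ.<_) (ℚₚ.+-identityˡ (ℚ.- c)) (p<q⇒0<q-p c<0)
      -- With this tolerance, `- c / 2`, a negative `c` still leaves the negative sum `c / 2`.
      (N , h) = F (½ ℚ.* (ℚ.- c)) (0<½ 0<-c)
      0<½-c = 0<½ 0<-c
  in ℚₚ.<-irrefl refl (ℚₚ.<-≤-trans 0<½-c
       (0≤q-p⇒p≤q (subst (0ℚ ℚ.≤_) (trans (cong (ℚ._+ ½ ℚ.* (ℚ.- c)) (negHalf c)) (final (½ ℚ.* (ℚ.- c)))) (h N ℕₚ.≤-refl))))
  where
  open +-*-Solver
  negHalf : ∀ c → c ≡ ℚ.- (½ ℚ.* (ℚ.- c) ℚ.+ ½ ℚ.* (ℚ.- c))
  negHalf c = trans (solve 1 (λ c → c := :- (:- c)) refl c) (cong ℚ.-_ (sym (half (ℚ.- c))))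
  final : ∀ h → ℚ.- (h ℚ.+ h) ℚ.+ h ≡ 0ℚ ℚ.- h
  final = solve 1 (λ h → :- (h :+ h) :+ h := con 0ℚ :- h) refl

≤ᵣ⇒limit≥0 : ∀ {x y} → x ≤ᵣ y → Limit≥0 (λ n → seq y n ℚ.- seq x n)
≤ᵣ⇒limit≥0 {x} {y} x≤y = limit≥0 λ ε 0<ε → proj₁ (x≤y ε 0<ε) , λ n n≥ →
  subst (0ℚ ℚ.≤_) (rearrange (seq x n) (seq y n) ε) (p≤q⇒0≤q-p (proj₂ (x≤y ε 0<ε) n n≥))
  where
  open +-*-Solver
  rearrange : ∀ x y e → y ℚ.+ e ℚ.- x ≡ y ℚ.- x ℚ.+ e
  rearrange = solve 3 (λ x y e → y :+ e :- x := y :- x :+ e) refl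

limit≥0⇒≤ᵣ : ∀ {x y} → Limit≥0 (λ n → seq y n ℚ.- seq x n) → x ≤ᵣ y
limit≥0⇒≤ᵣ {x} {y} (limit≥0 F) ε 0<ε = proj₁ (F ε 0<ε) , λ n n≥ →
  0≤q-p⇒p≤q (subst (0ℚ ℚ.≤_) (rearrange (seq x n) (seq y n) ε) (proj₂ (F ε 0<ε) n n≥))
  where
  open +-*-Solver
  rearrange : ∀ x y e → y ℚ.- x ℚ.+ e ≡ y ℚ.+ e ℚ.- x
  rearrange = solve 3 (λ x y e → y :- x :+ e := y :+ e :- x) refl

fromℚ-mono : ∀ {p q} → p ℚ.≤ q → fromℚ p ≤ᵣ fromℚ q
fromℚ-mono {p} {q} p≤q ε 0<ε = 0 , λ _ _ →
  ℚₚ.≤-trans p≤q (subst (ℚ._≤ q ℚ.+ ε) (ℚₚ.+-identityʳ q) (ℚₚ.+-monoʳ-≤ q (ℚₚ.<⇒≤ 0<ε)))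

null-cong : ∀ {f g} → (∀ n → f n ≡ g n) → Null f → Null g
null-cong eq (F , F′) = limit≥0-cong eq F , limit≥0-cong (cong ℚ.-_ ∘ eq) F′

null-+ : ∀ {f g} → Null f → Null g → Null (λ n → f n ℚ.+ g n)
null-+ {f} {g} (F , F′) (G , G′) = limit≥0-+ F G ,
  limit≥0-cong (λ n → sym (ℚₚ.neg-distrib-+ (f n) (g n))) (limit≥0-+ F′ G′)

null-* : ∀ {f} c → Null f → Null (λ n → c ℚ.* f n)
null-* {f} c (F , F′) = [ nonneg , nonpos ]′ (ℚₚ.≤-total 0ℚ c)
  where
  open +-*-Solver
  e₁ : ∀ c x → c ℚ.* (ℚ.- x) ≡ ℚ.- (c ℚ.* x)
  e₁ = solve 2 (λ c x → c :* (:- x) := :- (c :* x)) refl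
  e₂ : ∀ c x → (ℚ.- c) ℚ.* (ℚ.- x) ≡ c ℚ.* x
  e₂ = solve 2 (λ c x → (:- c) :* (:- x) := c :* x) refl
  e₃ : ∀ c x → (ℚ.- c) ℚ.* x ≡ ℚ.- (c ℚ.* x)
  e₃ = solve 2 (λ c x → (:- c) :* x := :- (c :* x)) refl
  nonneg : 0ℚ ℚ.≤ c → Null (λ n → c ℚ.* f n)
  nonneg 0≤c = limit≥0-* c 0≤c F , limit≥0-cong (λ n → e₁ c (f n)) (limit≥0-* c 0≤c F′)
  nonpos : c ℚ.≤ 0ℚ → Null (λ n → c ℚ.* f n)
  nonpos c≤0 = limit≥0-cong (λ n → e₂ c (f n)) (limit≥0-* (ℚ.- c) 0≤-c F′) ,
               limit≥0-cong (λ n → e₃ c (f n)) (limit≥0-* (ℚ.- c) 0≤-c F)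
    where
    0≤-c = ℚₚ.neg-antimono-≤ c≤0

-- The workhorse for real points: a new relation is a rational combination of two known ones, and
-- only a polynomial identity at each index remains to be checked.
null-combination : ∀ {f g h} a b → Null f → Null g →
  (∀ n → a ℚ.* f n ℚ.+ b ℚ.* g n ≡ h n) → Null h
null-combination a b F G eq = null-cong eq (null-+ (null-* a F) (null-* b G))

-- The way back from limits to exact equations between rationals.
null-const : ∀ {c} → Null (λ _ → c) → c ≡ 0ℚ
null-const {c} (F , F′) = ℚₚ.≤-antisym
  (subst (ℚ._≤ 0ℚ) (solve 1 (λ c → :- (:- c) := c) refl c) (ℚₚ.neg-antimono-≤ (limit≥0-const F′)))
  (limit≥0-const F)
  where open +-*-Solver

null-0 : Null (λ _ → 0ℚ)
null-0 = limit≥0 (λ ε 0<ε → 0 , λ _ _ → 0≤+ ℚₚ.≤-refl (ℚₚ.<⇒≤ 0<ε)) ,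
         limit≥0 (λ ε 0<ε → 0 , λ _ _ → 0≤+ ℚₚ.≤-refl (ℚₚ.<⇒≤ 0<ε))

≈⇒null : ∀ {x y} → x ≈ y → Null (λ n → seq x n ℚ.- seq y n)
≈⇒null {x} {y} x≈y =
  limit≥0 (λ ε 0<ε → proj₁ (x≈y ε 0<ε) , λ n n≥ → ∣p∣≤q⇒0≤p+q (proj₂ (x≈y ε 0<ε) n n≥)) ,
  limit≥0 (λ ε 0<ε → proj₁ (x≈y ε 0<ε) , λ n n≥ → ∣p∣≤q⇒0≤p+q
    (subst (ℚ._≤ ε) (sym (ℚₚ.∣-p∣≡∣p∣ (seq x n ℚ.- seq y n))) (proj₂ (x≈y ε 0<ε) n n≥)))

null⇒≈ : ∀ {x y} → Null (λ n → seq x n ℚ.- seq y n) → x ≈ y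
null⇒≈ (limit≥0 F , limit≥0 F′) ε 0<ε = M ⊔ N , λ n n≥ →
  0≤±p+q⇒∣p∣≤q (proj₂ (F ε 0<ε) n (⊔ˡ n≥)) (proj₂ (F′ ε 0<ε) n (⊔ʳ {M} n≥))
  where
  M = proj₁ (F ε 0<ε)
  N = proj₁ (F′ ε 0<ε)

p-q≡0⇒p≡q : ∀ {p q} → p ℚ.- q ≡ 0ℚ → p ≡ q
p-q≡0⇒p≡q {p} {q} eq = trans (split p q) (trans (cong (ℚ._+ q) eq) (ℚₚ.+-identityˡ q))
  where
  open +-*-Solver
  split : ∀ p q → p ≡ p ℚ.- q ℚ.+ q
  split = solve 2 (λ p q → p := p :- q :+ q) refl

fromℚ-injective : ∀ {p q} → fromℚ p ≈ fromℚ q → p ≡ q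
fromℚ-injective {p} {q} h = p-q≡0⇒p≡q (null-const (≈⇒null {fromℚ p} {fromℚ q} h))

p*q≡0⇒p≡0∨q≡0 : ∀ {p q} → p ℚ.* q ≡ 0ℚ → p ≡ 0ℚ ⊎ q ≡ 0ℚ
p*q≡0⇒p≡0∨q≡0 {p} {q} pq≡0 = by (p ℚₚ.≟ 0ℚ)
  where
  by : Dec (p ≡ 0ℚ) → p ≡ 0ℚ ⊎ q ≡ 0ℚ
  by (yes p≡0) = inj₁ p≡0
  by (no p≢0) = inj₂ (trans (sym (ℚₚ.*-identityˡ q))
    (trans (cong (ℚ._* q) (sym (ℚₚ.*-inverseˡ p)))
    (trans (ℚₚ.*-assoc (ℚ.1/ p) p q) (trans (cong (ℚ.1/ p ℚ.*_) pq≡0) (ℚₚ.*-zeroʳ (ℚ.1/ p))))))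
    where
    instance
      nz : ℚ.NonZero p
      nz = ℚ.≢-nonZero p≢0

null-cancel : ∀ {f} c → c ≢ 0ℚ → Null (λ n → c ℚ.* f n) → Null f
null-cancel {f} c c≢0 F = null-cong (λ n → trans (sym (ℚₚ.*-assoc (ℚ.1/ c) c (f n)))
    (trans (cong (ℚ._* f n) (ℚₚ.*-inverseˡ c)) (ℚₚ.*-identityˡ (f n))))
  (null-* (ℚ.1/ c) F)
  where
  instance
    nz : ℚ.NonZero c
    nz = ℚ.≢-nonZero c≢0

-- If β ≤ α then (1 - t) (α - β) has nonnegative limit and tends to -β < 0; likewise if α ≤ β.
convex-combination-not-null : ∀ t {α β} → 0ᵣ ≤ᵣ t → t ≤ᵣ 1ᵣ → 0ℚ ℚ.< α → 0ℚ ℚ.< β →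
  ¬ Null (λ n → (1ℚ ℚ.- seq t n) ℚ.* α ℚ.+ seq t n ℚ.* β)
convex-combination-not-null t {α} {β} 0≤t t≤1 0<α 0<β (_ , F′) =
  [ (λ β≤α → impossible 0<β (limit≥0-cong (λ n → e₁ (seq t n) α β)
        (limit≥0-+ (limit≥0-* (α ℚ.- β) (p≤q⇒0≤q-p β≤α) (≤ᵣ⇒limit≥0 {t} {1ᵣ} t≤1)) F′)))
  , (λ α≤β → impossible 0<α (limit≥0-cong (λ n → e₂ (seq t n) α β)
        (limit≥0-+ (limit≥0-* (β ℚ.- α) (p≤q⇒0≤q-p α≤β) (≤ᵣ⇒limit≥0 {0ᵣ} {t} 0≤t)) F′)))
  ]′ (ℚₚ.≤-total β α)
  where
  open +-*-Solver
  e₁ : ∀ t α β → (α ℚ.- β) ℚ.* (1ℚ ℚ.- t) ℚ.+ ℚ.- ((1ℚ ℚ.- t) ℚ.* α ℚ.+ t ℚ.* β) ≡ 0ℚ ℚ.- β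
  e₁ = solve 3 (λ t α β → (α :- β) :* (con 1ℚ :- t) :+ :- ((con 1ℚ :- t) :* α :+ t :* β) := con 0ℚ :- β) refl
  e₂ : ∀ t α β → (β ℚ.- α) ℚ.* (t ℚ.- 0ℚ) ℚ.+ ℚ.- ((1ℚ ℚ.- t) ℚ.* α ℚ.+ t ℚ.* β) ≡ 0ℚ ℚ.- α
  e₂ = solve 3 (λ t α β → (β :- α) :* (t :- con 0ℚ) :+ :- ((con 1ℚ :- t) :* α :+ t :* β) := con 0ℚ :- α) refl
  impossible : ∀ {c} → 0ℚ ℚ.< c → ¬ Limit≥0 (λ _ → 0ℚ ℚ.- c)
  impossible 0<c G = ℚₚ.<-irrefl refl (ℚₚ.<-≤-trans 0<c (0≤q-p⇒p≤q (limit≥0-const G)))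

-- Chords of the parabola

parabola : ℚ → Point
parabola a = fromℚ a , fromℚ (a ℚ.* a)

-- Vanishes exactly on the line through the points of the parabola with abscissae a and b.
chordForm : ℚ → ℚ → ℚ → ℚ → ℚ
chordForm a b x y = y ℚ.- (a ℚ.+ b) ℚ.* x ℚ.+ a ℚ.* b

record OnLineThrough (a b : ℚ) (P : Point) : Set where
  constructor onLine
  field
    null : Null λ n → chordForm a b (seq (proj₁ P) n) (seq (proj₂ P) n)

record OnChord (a b : ℚ) (P : Point) : Set where
  field
    t   : ℝ
    0≤t : 0ᵣ ≤ᵣ t
    t≤1 : t ≤ᵣ 1ᵣ
    x≈  : Null λ n → seq (proj₁ P) n ℚ.- ((1ℚ ℚ.- seq t n) ℚ.* a ℚ.+ seq t n ℚ.* b)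
    y≈  : Null λ n → seq (proj₂ P) n ℚ.-
            ((1ℚ ℚ.- seq t n) ℚ.* (a ℚ.* a) ℚ.+ seq t n ℚ.* (b ℚ.* b))

toChord : ∀ {a b P} → OnSegment (parabola a) (parabola b) P → OnChord a b P
toChord {a} {b} {x , y} (t , 0≤t , t≤1 , x≈ , y≈) = record
  { t = t ; 0≤t = 0≤t ; t≤1 = t≤1
  ; x≈ = ≈⇒null {x} {(1ᵣ -ᵣ t) *ᵣ fromℚ a +ᵣ t *ᵣ fromℚ b} x≈
  ; y≈ = ≈⇒null {y} {(1ᵣ -ᵣ t) *ᵣ fromℚ (a ℚ.* a) +ᵣ t *ᵣ fromℚ (b ℚ.* b)} y≈ }

fromChord : ∀ {a b P} → OnChord a b P → OnSegment (parabola a) (parabola b) P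
fromChord {a} {b} {x , y} p = t , 0≤t , t≤1 ,
  null⇒≈ {x} {(1ᵣ -ᵣ t) *ᵣ fromℚ a +ᵣ t *ᵣ fromℚ b} x≈ ,
  null⇒≈ {y} {(1ᵣ -ᵣ t) *ᵣ fromℚ (a ℚ.* a) +ᵣ t *ᵣ fromℚ (b ℚ.* b)} y≈
  where open OnChord p

-- `chordForm c d` is affine and takes the value `(z - c) * (z - d)` at the point of the parabola
-- with abscissa `z`, so along a chord it interpolates between its values at the two ends.
chordForm-on-chord : ∀ {a b P} c d (p : OnChord a b P) → let open OnChord p in
  Null λ n → chordForm c d (seq (proj₁ P) n) (seq (proj₂ P) n) ℚ.-
    ((1ℚ ℚ.- seq t n) ℚ.* ((a ℚ.- c) ℚ.* (a ℚ.- d)) ℚ.+ seq t n ℚ.* ((b ℚ.- c) ℚ.* (b ℚ.- d)))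
chordForm-on-chord {a} {b} {x , y} c d p =
  null-combination (ℚ.- (c ℚ.+ d)) 1ℚ x≈ y≈ λ n → identity a b c d (seq t n) (seq x n) (seq y n)
  where
  open OnChord p
  open +-*-Solver
  identity : ∀ a b c d t x y →
    ℚ.- (c ℚ.+ d) ℚ.* (x ℚ.- ((1ℚ ℚ.- t) ℚ.* a ℚ.+ t ℚ.* b)) ℚ.+
      1ℚ ℚ.* (y ℚ.- ((1ℚ ℚ.- t) ℚ.* (a ℚ.* a) ℚ.+ t ℚ.* (b ℚ.* b))) ≡
    chordForm c d x y ℚ.-
      ((1ℚ ℚ.- t) ℚ.* ((a ℚ.- c) ℚ.* (a ℚ.- d)) ℚ.+ t ℚ.* ((b ℚ.- c) ℚ.* (b ℚ.- d)))
  identity = solve 7 (λ a b c d t x y →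
    :- (c :+ d) :* (x :- ((con 1ℚ :- t) :* a :+ t :* b)) :+
      con 1ℚ :* (y :- ((con 1ℚ :- t) :* (a :* a) :+ t :* (b :* b))) :=
    (y :- (c :+ d) :* x :+ c :* d) :-
      ((con 1ℚ :- t) :* ((a :- c) :* (a :- d)) :+ t :* ((b :- c) :* (b :- d)))) refl

chord⊆line : ∀ {a b P} → OnChord a b P → OnLineThrough a b P
chord⊆line {a} {b} {x , y} on = onLine (
  null-cong (λ n → identity a b (seq t n) (chordForm a b (seq x n) (seq y n)))
    (chordForm-on-chord a b on))
  where
  open OnChord on
  open +-*-Solver
  identity : ∀ a b t z → z ℚ.-
      ((1ℚ ℚ.- t) ℚ.* ((a ℚ.- a) ℚ.* (a ℚ.- b)) ℚ.+ t ℚ.* ((b ℚ.- a) ℚ.* (b ℚ.- b))) ≡ z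
  identity = solve 4 (λ a b t z → z :-
    ((con 1ℚ :- t) :* ((a :- a) :* (a :- b)) :+ t :* ((b :- a) :* (b :- b))) := z) refl

-- The scale σ makes one lemma of the cases "both outside" and "both inside" the second chord.
chords-apart : ∀ {a b c d P} σ →
  0ℚ ℚ.< σ ℚ.* ((a ℚ.- c) ℚ.* (a ℚ.- d)) → 0ℚ ℚ.< σ ℚ.* ((b ℚ.- c) ℚ.* (b ℚ.- d)) →
  OnChord a b P → OnLineThrough c d P → ⊥
chords-apart {a} {b} {c} {d} {x , y} σ 0<α 0<β on (onLine null) =
  convex-combination-not-null t 0≤t t≤1 0<α 0<β
    (null-combination σ (ℚ.- σ) null (chordForm-on-chord c d on)
      λ n → identity σ ((a ℚ.- c) ℚ.* (a ℚ.- d)) ((b ℚ.- c) ℚ.* (b ℚ.- d)) (seq t n)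
              (chordForm c d (seq x n) (seq y n)))
  where
  open OnChord on
  open +-*-Solver
  identity : ∀ σ α β t z → σ ℚ.* z ℚ.+ ℚ.- σ ℚ.* (z ℚ.- ((1ℚ ℚ.- t) ℚ.* α ℚ.+ t ℚ.* β)) ≡
    (1ℚ ℚ.- t) ℚ.* (σ ℚ.* α) ℚ.+ t ℚ.* (σ ℚ.* β)
  identity = solve 5 (λ σ α β t z → σ :* z :+ :- σ :* (z :- ((con 1ℚ :- t) :* α :+ t :* β)) :=
    (con 1ℚ :- t) :* (σ :* α) :+ t :* (σ :* β)) refl

p≢q⇒p-q≢0 : ∀ {p q} → p ≢ q → p ℚ.- q ≢ 0ℚ
p≢q⇒p-q≢0 p≢q = p≢q ∘ p-q≡0⇒p≡q

-- At the shared end the form of the second line vanishes, so along the first chord it equals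
-- `t * (b - a) * (b - d)`. Hence `t` tends to 0, which is the end `a`.
chords-at-common-end : ∀ {a b d P} → a ≢ b → b ≢ d →
  OnChord a b P → OnLineThrough a d P → P ≈ₚ parabola a
chords-at-common-end {a} {b} {d} {x , y} a≢b b≢d on (onLine null) =
  null⇒≈ {x} {fromℚ a}
    (null-combination 1ℚ (b ℚ.- a) x≈ t-null λ n → x-identity a b (seq t n) (seq x n)) ,
  null⇒≈ {y} {fromℚ (a ℚ.* a)}
    (null-combination 1ℚ (b ℚ.* b ℚ.- a ℚ.* a) y≈ t-null
      λ n → x-identity (a ℚ.* a) (b ℚ.* b) (seq t n) (seq y n))
  where
  open OnChord on
  open +-*-Solver
  identity : ∀ a b d t z → 1ℚ ℚ.* z ℚ.+ ℚ.- 1ℚ ℚ.* (z ℚ.-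
      ((1ℚ ℚ.- t) ℚ.* ((a ℚ.- a) ℚ.* (a ℚ.- d)) ℚ.+ t ℚ.* ((b ℚ.- a) ℚ.* (b ℚ.- d)))) ≡
    (b ℚ.- a) ℚ.* ((b ℚ.- d) ℚ.* t)
  identity = solve 5 (λ a b d t z → con 1ℚ :* z :+ con (ℚ.- 1ℚ) :* (z :-
      ((con 1ℚ :- t) :* ((a :- a) :* (a :- d)) :+ t :* ((b :- a) :* (b :- d)))) :=
    (b :- a) :* ((b :- d) :* t)) refl
  x-identity : ∀ a b t x →
    1ℚ ℚ.* (x ℚ.- ((1ℚ ℚ.- t) ℚ.* a ℚ.+ t ℚ.* b)) ℚ.+ (b ℚ.- a) ℚ.* t ≡ x ℚ.- a
  x-identity = solve 4 (λ a b t x →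
    con 1ℚ :* (x :- ((con 1ℚ :- t) :* a :+ t :* b)) :+ (b :- a) :* t := x :- a) refl
  t-null : Null (seq t)
  t-null = null-cancel (b ℚ.- d) (p≢q⇒p-q≢0 b≢d) (null-cancel (b ℚ.- a) (p≢q⇒p-q≢0 (a≢b ∘ sym))
    (null-combination 1ℚ (ℚ.- 1ℚ) null (chordForm-on-chord a d on)
      λ n → identity a b d (seq t n) (chordForm a d (seq x n) (seq y n))))

parabola∩line : ∀ {c d v P} → P ≈ₚ parabola v → OnLineThrough c d P → v ≡ c ⊎ v ≡ d
parabola∩line {c} {d} {v} {x , y} (x≈v , y≈v²) (onLine null) =
  [ (λ eq → inj₁ (p-q≡0⇒p≡q eq)) , (λ eq → inj₂ (p-q≡0⇒p≡q eq)) ]′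
    (p*q≡0⇒p≡0∨q≡0 (null-const (null-combination 1ℚ 1ℚ null
      (null-combination (c ℚ.+ d) (ℚ.- 1ℚ) (≈⇒null {x} {fromℚ v} x≈v) (≈⇒null {y} {fromℚ (v ℚ.* v)} y≈v²)
        λ n → refl)
      λ n → identity c d v (seq x n) (seq y n))))
  where
  open +-*-Solver
  identity : ∀ c d v x y → 1ℚ ℚ.* chordForm c d x y ℚ.+
      1ℚ ℚ.* ((c ℚ.+ d) ℚ.* (x ℚ.- v) ℚ.+ ℚ.- 1ℚ ℚ.* (y ℚ.- v ℚ.* v)) ≡
    (v ℚ.- c) ℚ.* (v ℚ.- d)
  identity = solve 5 (λ c d v x y → con 1ℚ :* (y :- (c :+ d) :* x :+ c :* d) :+
      con 1ℚ :* ((c :+ d) :* (x :- v) :+ con (ℚ.- 1ℚ) :* (y :- v :* v)) :=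
    (v :- c) :* (v :- d)) refl

onChord-sym : ∀ {a b P} → OnChord a b P → OnChord b a P
onChord-sym {a} {b} {x , y} on = record
  { t = 1ᵣ -ᵣ t
  ; 0≤t = limit≥0⇒≤ᵣ {0ᵣ} {1ᵣ -ᵣ t} (limit≥0-cong (λ n → e₁ (seq t n)) (≤ᵣ⇒limit≥0 {t} {1ᵣ} t≤1))
  ; t≤1 = limit≥0⇒≤ᵣ {1ᵣ -ᵣ t} {1ᵣ} (limit≥0-cong (λ n → e₂ (seq t n)) (≤ᵣ⇒limit≥0 {0ᵣ} {t} 0≤t))
  ; x≈ = null-cong (λ n → e₃ a b (seq t n) (seq x n)) x≈
  ; y≈ = null-cong (λ n → e₃ (a ℚ.* a) (b ℚ.* b) (seq t n) (seq y n)) y≈ }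
  where
  open OnChord on
  open +-*-Solver
  e₁ : ∀ t → 1ℚ ℚ.- t ≡ (1ℚ ℚ.- t) ℚ.- 0ℚ
  e₁ = solve 1 (λ t → con 1ℚ :- t := (con 1ℚ :- t) :- con 0ℚ) refl
  e₂ : ∀ t → t ℚ.- 0ℚ ≡ 1ℚ ℚ.- (1ℚ ℚ.- t)
  e₂ = solve 1 (λ t → t :- con 0ℚ := con 1ℚ :- (con 1ℚ :- t)) refl
  e₃ : ∀ a b t x → x ℚ.- ((1ℚ ℚ.- t) ℚ.* a ℚ.+ t ℚ.* b) ≡
    x ℚ.- ((1ℚ ℚ.- (1ℚ ℚ.- t)) ℚ.* b ℚ.+ (1ℚ ℚ.- t) ℚ.* a)
  e₃ = solve 4 (λ a b t x → x :- ((con 1ℚ :- t) :* a :+ t :* b) :=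
    x :- ((con 1ℚ :- (con 1ℚ :- t)) :* b :+ (con 1ℚ :- t) :* a)) refl

-- Intersections of chords

-- Totalised by inverse 0 = 0.
inverse : ℚ → ℚ
inverse q = by (q ℚₚ.≟ 0ℚ)
  where
  by : Dec (q ≡ 0ℚ) → ℚ
  by (yes _) = 0ℚ
  by (no q≢0) = (ℚ.1/ q) {{ℚ.≢-nonZero q≢0}}

*-inverse : ∀ {q} → q ≢ 0ℚ → q ℚ.* inverse q ≡ 1ℚ
*-inverse {q} q≢0 with q ℚₚ.≟ 0ℚ
... | yes q≡0 = ⊥-elim (q≢0 q≡0)
... | no q≢0′ = ℚₚ.*-inverseʳ q {{ℚ.≢-nonZero q≢0′}}

0<q⇒q≢0 : ∀ {q} → 0ℚ ℚ.< q → q ≢ 0ℚ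
0<q⇒q≢0 0<q q≡0 = ℚₚ.<-irrefl (sym q≡0) 0<q

0≤*-cancelˡ : ∀ {r q} → 0ℚ ℚ.< r → 0ℚ ℚ.≤ r ℚ.* q → 0ℚ ℚ.≤ q
0≤*-cancelˡ {r} {q} 0<r 0≤rq =
  ℚₚ.*-cancelˡ-≤-pos r {{ℚ.positive 0<r}} (subst (ℚ._≤ r ℚ.* q) (sym (ℚₚ.*-zeroʳ r)) 0≤rq)

-- The solution of `(a + b) x - a b = (c + d) x - c d`, where the lines through the two pairs of
-- points have equal height.
crossingX crossingY : ℚ → ℚ → ℚ → ℚ → ℚ
crossingX a b c d = (c ℚ.* d ℚ.- a ℚ.* b) ℚ.* inverse (c ℚ.+ d ℚ.- (a ℚ.+ b))
crossingY a b c d = (a ℚ.+ b) ℚ.* crossingX a b c d ℚ.- a ℚ.* b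

rationalPoint : ℚ × ℚ → Point
rationalPoint (x , y) = fromℚ x , fromℚ y

rationalPoint-onChord : ∀ {a b x y} → a ℚ.< b → 0ℚ ℚ.≤ x ℚ.- a → 0ℚ ℚ.≤ b ℚ.- x →
  y ≡ (a ℚ.+ b) ℚ.* x ℚ.- a ℚ.* b → OnChord a b (rationalPoint (x , y))
rationalPoint-onChord {a} {b} {x} {y} a<b a≤x x≤b y≡ = record
  { t = fromℚ t
  ; 0≤t = fromℚ-mono {0ℚ} {t} 0≤t
  ; t≤1 = fromℚ-mono {t} {1ℚ} (0≤q-p⇒p≤q 0≤1-t)
  ; x≈ = null-cong (λ _ → sym x-eq) null-0
  ; y≈ = null-cong (λ _ → sym y-eq) null-0 }
  where
  open +-*-Solver
  0<b-a = p<q⇒0<q-p a<b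
  t = inverse (b ℚ.- a) ℚ.* (x ℚ.- a)
  t-spec : (b ℚ.- a) ℚ.* t ≡ x ℚ.- a
  t-spec = trans (sym (ℚₚ.*-assoc (b ℚ.- a) (inverse (b ℚ.- a)) (x ℚ.- a)))
    (trans (cong (ℚ._* (x ℚ.- a)) (*-inverse (0<q⇒q≢0 0<b-a))) (ℚₚ.*-identityˡ (x ℚ.- a)))
  0≤t : 0ℚ ℚ.≤ t
  0≤t = 0≤*-cancelˡ 0<b-a (subst (0ℚ ℚ.≤_) (sym t-spec) a≤x)
  e₁ : ∀ a b x t → (b ℚ.- a) ℚ.* (1ℚ ℚ.- t) ≡ (b ℚ.- x) ℚ.+ ((x ℚ.- a) ℚ.- (b ℚ.- a) ℚ.* t)
  e₁ = solve 4 (λ a b x t → (b :- a) :* (con 1ℚ :- t) := (b :- x) :+ ((x :- a) :- (b :- a) :* t)) refl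
  vanish : (x ℚ.- a) ℚ.- (b ℚ.- a) ℚ.* t ≡ 0ℚ
  vanish = trans (cong (λ z → (x ℚ.- a) ℚ.- z) t-spec) (ℚₚ.+-inverseʳ (x ℚ.- a))
  0≤1-t : 0ℚ ℚ.≤ 1ℚ ℚ.- t
  0≤1-t = 0≤*-cancelˡ 0<b-a (subst (0ℚ ℚ.≤_)
    (trans (sym (ℚₚ.+-identityʳ (b ℚ.- x))) (trans (cong (b ℚ.- x ℚ.+_) (sym vanish)) (sym (e₁ a b x t)))) x≤b)
  e₂ : ∀ a b x t → x ℚ.- ((1ℚ ℚ.- t) ℚ.* a ℚ.+ t ℚ.* b) ≡ (x ℚ.- a) ℚ.- (b ℚ.- a) ℚ.* t
  e₂ = solve 4 (λ a b x t → x :- ((con 1ℚ :- t) :* a :+ t :* b) := (x :- a) :- (b :- a) :* t) refl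
  x-eq : x ℚ.- ((1ℚ ℚ.- t) ℚ.* a ℚ.+ t ℚ.* b) ≡ 0ℚ
  x-eq = trans (e₂ a b x t) vanish
  e₃ : ∀ a b x t → ((a ℚ.+ b) ℚ.* x ℚ.- a ℚ.* b) ℚ.-
      ((1ℚ ℚ.- t) ℚ.* (a ℚ.* a) ℚ.+ t ℚ.* (b ℚ.* b)) ≡
    (a ℚ.+ b) ℚ.* ((x ℚ.- a) ℚ.- (b ℚ.- a) ℚ.* t)
  e₃ = solve 4 (λ a b x t → ((a :+ b) :* x :- a :* b) :-
      ((con 1ℚ :- t) :* (a :* a) :+ t :* (b :* b)) :=
    (a :+ b) :* ((x :- a) :- (b :- a) :* t)) refl
  y-eq : y ℚ.- ((1ℚ ℚ.- t) ℚ.* (a ℚ.* a) ℚ.+ t ℚ.* (b ℚ.* b)) ≡ 0ℚ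
  y-eq = trans (cong (λ z → z ℚ.- ((1ℚ ℚ.- t) ℚ.* (a ℚ.* a) ℚ.+ t ℚ.* (b ℚ.* b))) y≡)
    (trans (e₃ a b x t) (trans (cong ((a ℚ.+ b) ℚ.*_) vanish) (ℚₚ.*-zeroʳ (a ℚ.+ b))))

crossing : ℚ → ℚ → ℚ → ℚ → ℚ × ℚ
crossing a b c d = crossingX a b c d , crossingY a b c d

module Alternating {a b c d} (a<c : a ℚ.< c) (c<b : c ℚ.< b) (b<d : b ℚ.< d) where
  private
    s = c ℚ.+ d ℚ.- (a ℚ.+ b)
    x = crossingX a b c d
    0≤c-a = ℚₚ.<⇒≤ (p<q⇒0<q-p a<c)
    0≤b-c = ℚₚ.<⇒≤ (p<q⇒0<q-p c<b)
    0≤d-b = ℚₚ.<⇒≤ (p<q⇒0<q-p b<d)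
    0≤d-a = ℚₚ.<⇒≤ (p<q⇒0<q-p (ℚₚ.<-trans a<c (ℚₚ.<-trans c<b b<d)))
    open +-*-Solver

    s-split : ∀ a b c d → (c ℚ.- a) ℚ.+ (d ℚ.- b) ≡ c ℚ.+ d ℚ.- (a ℚ.+ b)
    s-split = solve 4 (λ a b c d → (c :- a) :+ (d :- b) := c :+ d :- (a :+ b)) refl

    0<s : 0ℚ ℚ.< s
    0<s = subst (0ℚ ℚ.<_) (s-split a b c d) (0<+ 0≤c-a (p<q⇒0<q-p b<d))

    s*x : s ℚ.* x ≡ c ℚ.* d ℚ.- a ℚ.* b
    s*x = trans (pull s (c ℚ.* d ℚ.- a ℚ.* b) (inverse s))
      (trans (cong ((c ℚ.* d ℚ.- a ℚ.* b) ℚ.*_) (*-inverse (0<q⇒q≢0 0<s))) (ℚₚ.*-identityʳ _))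
      where
      pull : ∀ s n i → s ℚ.* (n ℚ.* i) ≡ n ℚ.* (s ℚ.* i)
      pull = solve 3 (λ s n i → s :* (n :* i) := n :* (s :* i)) refl

    y-via-cd : ∀ a b c d x → (a ℚ.+ b) ℚ.* x ℚ.- a ℚ.* b ≡
      ((c ℚ.+ d) ℚ.* x ℚ.- c ℚ.* d) ℚ.- ((c ℚ.+ d ℚ.- (a ℚ.+ b)) ℚ.* x ℚ.- (c ℚ.* d ℚ.- a ℚ.* b))
    y-via-cd = solve 5 (λ a b c d x → (a :+ b) :* x :- a :* b :=
      ((c :+ d) :* x :- c :* d) :- ((c :+ d :- (a :+ b)) :* x :- (c :* d :- a :* b))) refl

    vanish : s ℚ.* x ℚ.- (c ℚ.* d ℚ.- a ℚ.* b) ≡ 0ℚ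
    vanish = trans (cong (ℚ._- (c ℚ.* d ℚ.- a ℚ.* b)) s*x) (ℚₚ.+-inverseʳ (c ℚ.* d ℚ.- a ℚ.* b))

    shift : ∀ {q r} → q ≡ (s ℚ.* x ℚ.- (c ℚ.* d ℚ.- a ℚ.* b)) ℚ.+ r → 0ℚ ℚ.≤ r → 0ℚ ℚ.≤ q
    shift {q} {r} q≡ 0≤r = subst (0ℚ ℚ.≤_)
      (sym (trans q≡ (trans (cong (ℚ._+ r) vanish) (ℚₚ.+-identityˡ r)))) 0≤r

    shift′ : ∀ {q r} → q ≡ r ℚ.- (s ℚ.* x ℚ.- (c ℚ.* d ℚ.- a ℚ.* b)) → 0ℚ ℚ.≤ r → 0ℚ ℚ.≤ q
    shift′ {q} {r} q≡ 0≤r = subst (0ℚ ℚ.≤_)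
      (sym (trans q≡ (trans (cong (λ z → r ℚ.- z) vanish) (ℚₚ.+-identityʳ r)))) 0≤r

    -- Since `s * x = c * d - a * b`, these four identities factor the distances from the crossing
    -- to the ends: `s (x - a) = (c - a) (d - a)`, `s (b - x) = (b - c) (d - b)`,
    -- `s (x - c) = (c - a) (b - c)` and `s (d - x) = (d - a) (d - b)`. Alternation makes every
    -- factor positive.
    i₁ : ∀ a b c d x → (c ℚ.+ d ℚ.- (a ℚ.+ b)) ℚ.* (x ℚ.- a) ≡
      ((c ℚ.+ d ℚ.- (a ℚ.+ b)) ℚ.* x ℚ.- (c ℚ.* d ℚ.- a ℚ.* b)) ℚ.+ (c ℚ.- a) ℚ.* (d ℚ.- a)
    i₁ = solve 5 (λ a b c d x → (c :+ d :- (a :+ b)) :* (x :- a) :=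
      ((c :+ d :- (a :+ b)) :* x :- (c :* d :- a :* b)) :+ (c :- a) :* (d :- a)) refl
    i₂ : ∀ a b c d x → (c ℚ.+ d ℚ.- (a ℚ.+ b)) ℚ.* (b ℚ.- x) ≡
      (b ℚ.- c) ℚ.* (d ℚ.- b) ℚ.- ((c ℚ.+ d ℚ.- (a ℚ.+ b)) ℚ.* x ℚ.- (c ℚ.* d ℚ.- a ℚ.* b))
    i₂ = solve 5 (λ a b c d x → (c :+ d :- (a :+ b)) :* (b :- x) :=
      (b :- c) :* (d :- b) :- ((c :+ d :- (a :+ b)) :* x :- (c :* d :- a :* b))) refl
    i₃ : ∀ a b c d x → (c ℚ.+ d ℚ.- (a ℚ.+ b)) ℚ.* (x ℚ.- c) ≡
      ((c ℚ.+ d ℚ.- (a ℚ.+ b)) ℚ.* x ℚ.- (c ℚ.* d ℚ.- a ℚ.* b)) ℚ.+ (c ℚ.- a) ℚ.* (b ℚ.- c)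
    i₃ = solve 5 (λ a b c d x → (c :+ d :- (a :+ b)) :* (x :- c) :=
      ((c :+ d :- (a :+ b)) :* x :- (c :* d :- a :* b)) :+ (c :- a) :* (b :- c)) refl
    i₄ : ∀ a b c d x → (c ℚ.+ d ℚ.- (a ℚ.+ b)) ℚ.* (d ℚ.- x) ≡
      (d ℚ.- a) ℚ.* (d ℚ.- b) ℚ.- ((c ℚ.+ d ℚ.- (a ℚ.+ b)) ℚ.* x ℚ.- (c ℚ.* d ℚ.- a ℚ.* b))
    i₄ = solve 5 (λ a b c d x → (c :+ d :- (a :+ b)) :* (d :- x) :=
      (d :- a) :* (d :- b) :- ((c :+ d :- (a :+ b)) :* x :- (c :* d :- a :* b))) refl

  crossing-on-first : OnChord a b (rationalPoint (crossing a b c d))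
  crossing-on-first = rationalPoint-onChord (ℚₚ.<-trans a<c c<b)
    (0≤*-cancelˡ 0<s (shift (i₁ a b c d x) (0≤* 0≤c-a 0≤d-a)))
    (0≤*-cancelˡ 0<s (shift′ (i₂ a b c d x) (0≤* 0≤b-c 0≤d-b)))
    refl

  crossing-on-second : OnChord c d (rationalPoint (crossing a b c d))
  crossing-on-second = rationalPoint-onChord (ℚₚ.<-trans c<b b<d)
    (0≤*-cancelˡ 0<s (shift (i₃ a b c d x) (0≤* 0≤c-a 0≤b-c)))
    (0≤*-cancelˡ 0<s (shift′ (i₄ a b c d x) (0≤* 0≤d-a 0≤d-b)))
    (trans (y-via-cd a b c d x)
      (trans (cong (λ z → ((c ℚ.+ d) ℚ.* x ℚ.- c ℚ.* d) ℚ.- z) vanish) (ℚₚ.+-identityʳ _)))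

  -- The two line equations differ by `s` times the deviation of the abscissa, and `s` is positive;
  -- the first line then determines the ordinate.
  crossing-unique : ∀ {P} → OnLineThrough a b P → OnLineThrough c d P →
    P ≈ₚ rationalPoint (crossing a b c d)
  crossing-unique {X , Y} (onLine ab) (onLine cd) =
    null⇒≈ {X} {fromℚ x} x-null ,
    null⇒≈ {Y} {fromℚ (crossingY a b c d)}
      (null-combination 1ℚ (a ℚ.+ b) ab x-null λ n → e₂ a b x (seq X n) (seq Y n))
    where
    e₁ : ∀ a b c d x y → 1ℚ ℚ.* chordForm a b x y ℚ.+ ℚ.- 1ℚ ℚ.* chordForm c d x y ≡
      (c ℚ.+ d ℚ.- (a ℚ.+ b)) ℚ.* x ℚ.- (c ℚ.* d ℚ.- a ℚ.* b)
    e₁ = solve 6 (λ a b c d x y → con 1ℚ :* (y :- (a :+ b) :* x :+ a :* b) :+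
        con (ℚ.- 1ℚ) :* (y :- (c :+ d) :* x :+ c :* d) :=
      (c :+ d :- (a :+ b)) :* x :- (c :* d :- a :* b)) refl
    e₃ : ∀ s x x₀ → s ℚ.* x ℚ.- s ℚ.* x₀ ≡ s ℚ.* (x ℚ.- x₀)
    e₃ = solve 3 (λ s x x₀ → s :* x :- s :* x₀ := s :* (x :- x₀)) refl
    e₂ : ∀ a b x₀ x y → 1ℚ ℚ.* chordForm a b x y ℚ.+ (a ℚ.+ b) ℚ.* (x ℚ.- x₀) ≡
      y ℚ.- ((a ℚ.+ b) ℚ.* x₀ ℚ.- a ℚ.* b)
    e₂ = solve 5 (λ a b x₀ x y → con 1ℚ :* (y :- (a :+ b) :* x :+ a :* b) :+ (a :+ b) :* (x :- x₀) :=
      y :- ((a :+ b) :* x₀ :- a :* b)) refl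
    x-null : Null λ n → seq X n ℚ.- x
    x-null = null-cancel s (0<q⇒q≢0 0<s) (null-combination 1ℚ (ℚ.- 1ℚ) ab cd λ n →
      trans (e₁ a b c d (seq X n) (seq Y n))
        (trans (cong (λ z → s ℚ.* seq X n ℚ.- z) (sym s*x)) (e₃ s (seq X n) x)))

-- Non-concurrence of three lines with rapidly growing abscissae

2ℚ : ℚ
2ℚ = 1ℚ ℚ.+ 1ℚ

-- Squaring a number from 2 on adds at least 1. The gap of a full unit, beyond strict growth, is
-- what the determinant below consumes.
square-step : ∀ {p q} → 2ℚ ℚ.≤ p → p ℚ.* p ℚ.≤ q → 0ℚ ℚ.≤ q ℚ.- p ℚ.- 1ℚ
square-step {p} {q} 2≤p p²≤q = subst (0ℚ ℚ.≤_) (identity p q)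
  (0≤+ (p≤q⇒0≤q-p p²≤q) (0≤+ (0≤* (p≤q⇒0≤q-p 2≤p) 0≤p+1) (ℚₚ.<⇒≤ (ℚₚ.positive⁻¹ 1ℚ))))
  where
  open +-*-Solver
  0≤p+1 : 0ℚ ℚ.≤ p ℚ.+ 1ℚ
  0≤p+1 = 0≤+ (ℚₚ.≤-trans (ℚₚ.<⇒≤ (ℚₚ.positive⁻¹ 2ℚ)) 2≤p) (ℚₚ.<⇒≤ (ℚₚ.positive⁻¹ 1ℚ))
  identity : ∀ p q → (q ℚ.- p ℚ.* p) ℚ.+ ((p ℚ.- 2ℚ) ℚ.* (p ℚ.+ 1ℚ) ℚ.+ 1ℚ) ≡ q ℚ.- p ℚ.- 1ℚ
  identity = solve 2 (λ p q →
    (q :- p :* p) :+ ((p :- con 2ℚ) :* (p :+ con 1ℚ) :+ con 1ℚ) := q :- p :- con 1ℚ) refl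

square-step-< : ∀ {p q} → 2ℚ ℚ.≤ p → p ℚ.* p ℚ.≤ q → p ℚ.< q
square-step-< {p} {q} 2≤p p²≤q = ℚₚ.<-≤-trans p<p+1 (0≤q-p⇒p≤q
  (subst (0ℚ ℚ.≤_) (identity p q) (square-step 2≤p p²≤q)))
  where
  open +-*-Solver
  identity : ∀ p q → q ℚ.- p ℚ.- 1ℚ ≡ q ℚ.- (p ℚ.+ 1ℚ)
  identity = solve 2 (λ p q → q :- p :- con 1ℚ := q :- (p :+ con 1ℚ)) refl
  p<p+1 : p ℚ.< p ℚ.+ 1ℚ
  p<p+1 = subst (ℚ._< p ℚ.+ 1ℚ) (ℚₚ.+-identityʳ p) (ℚₚ.+-monoʳ-< p (ℚₚ.positive⁻¹ 1ℚ))

-- Eliminating x and y from the three line equations leaves a determinant, which is linear in f;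
-- it is positive because its coefficient of f is at least 1 and f ≥ d² outweighs e c d.
lines-not-concurrent : ∀ {a b c d e f P} → 2ℚ ℚ.≤ a →
  a ℚ.* a ℚ.≤ c → c ℚ.* c ℚ.≤ e → e ℚ.* e ℚ.≤ b → b ℚ.* b ℚ.≤ d → d ℚ.* d ℚ.≤ f →
  OnLineThrough a b P → OnLineThrough c d P → OnLineThrough e f P → ⊥
lines-not-concurrent {a} {b} {c} {d} {e} {f} {x , y} 2≤a a²≤c c²≤e e²≤b b²≤d d²≤f
  (onLine ab) (onLine cd) (onLine ef) = ℚₚ.<-irrefl (sym D≡0) 0<D
  where
  open +-*-Solver
  a<c = square-step-< 2≤a a²≤c
  2≤c = ℚₚ.≤-trans 2≤a (ℚₚ.<⇒≤ a<c)
  c<e = square-step-< 2≤c c²≤e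
  2≤e = ℚₚ.≤-trans 2≤c (ℚₚ.<⇒≤ c<e)
  e<b = square-step-< 2≤e e²≤b
  2≤b = ℚₚ.≤-trans 2≤e (ℚₚ.<⇒≤ e<b)
  b<d = square-step-< 2≤b b²≤d
  2≤d = ℚₚ.≤-trans 2≤b (ℚₚ.<⇒≤ b<d)
  d<f = square-step-< 2≤d d²≤f
  0≤ : ∀ {p} → 2ℚ ℚ.≤ p → 0ℚ ℚ.≤ p
  0≤ = ℚₚ.≤-trans (ℚₚ.<⇒≤ (ℚₚ.positive⁻¹ 2ℚ))
  0< : ∀ {p} → 2ℚ ℚ.≤ p → 0ℚ ℚ.< p
  0< = ℚₚ.<-≤-trans (ℚₚ.positive⁻¹ 2ℚ)
  ec≤d : e ℚ.* c ℚ.≤ d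
  ec≤d = ℚₚ.≤-trans (ℚₚ.*-monoˡ-≤-nonNeg e {{ℚ.nonNegative (0≤ 2≤e)}} (ℚₚ.<⇒≤ c<e))
    (ℚₚ.≤-trans e²≤b (ℚₚ.<⇒≤ b<d))
  1≤b : 0ℚ ℚ.≤ b ℚ.- 1ℚ
  1≤b = p≤q⇒0≤q-p (ℚₚ.≤-trans (ℚₚ.≤-reflexive (sym (ℚₚ.+-identityʳ 1ℚ)))
    (ℚₚ.≤-trans (ℚₚ.+-monoʳ-≤ 1ℚ (ℚₚ.<⇒≤ (ℚₚ.positive⁻¹ 1ℚ))) 2≤b))
  0≤c-a = p≤q⇒0≤q-p (ℚₚ.<⇒≤ a<c)
  -- The coefficient of `f` in `D`, less 1. That coefficient is `d (e - c) + e (c - a) + a b - b e`;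
  -- its one negative term is outweighed because `e - c ≥ 1`, `d ≥ b * b` and `b ≥ e + 1`, which the
  -- grouping makes visible.
  K-1 = (e ℚ.- c ℚ.- 1ℚ) ℚ.* d ℚ.+ ((d ℚ.- b ℚ.* b) ℚ.+ (b ℚ.* (b ℚ.- e ℚ.- 1ℚ) ℚ.+
        ((b ℚ.- 1ℚ) ℚ.+ (e ℚ.* (c ℚ.- a) ℚ.+ a ℚ.* b))))
  0≤K-1 : 0ℚ ℚ.≤ K-1
  0≤K-1 = 0≤+ (0≤* (square-step 2≤c c²≤e) (0≤ 2≤d)) (0≤+ (p≤q⇒0≤q-p b²≤d)
    (0≤+ (0≤* (0≤ 2≤b) (square-step 2≤e e²≤b)) (0≤+ 1≤b
    (0≤+ (0≤* (0≤ 2≤e) 0≤c-a) (0≤* (0≤ 2≤a) (0≤ 2≤b))))))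
  S₁ = a ℚ.+ b
  S₂ = c ℚ.+ d
  S₃ = e ℚ.+ f
  D = (S₃ ℚ.- S₂) ℚ.* (a ℚ.* b) ℚ.+ ((S₁ ℚ.- S₃) ℚ.* (c ℚ.* d) ℚ.+ (S₂ ℚ.- S₁) ℚ.* (e ℚ.* f))
  D-split : ∀ a b c d e f →
    ((e ℚ.- c ℚ.- 1ℚ) ℚ.* d ℚ.+ ((d ℚ.- b ℚ.* b) ℚ.+ (b ℚ.* (b ℚ.- e ℚ.- 1ℚ) ℚ.+
        ((b ℚ.- 1ℚ) ℚ.+ (e ℚ.* (c ℚ.- a) ℚ.+ a ℚ.* b))))) ℚ.* f ℚ.+
      ((f ℚ.- d ℚ.* d) ℚ.+ (d ℚ.* (d ℚ.- e ℚ.* c) ℚ.+ (a ℚ.* c ℚ.* (d ℚ.- b) ℚ.+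
      (b ℚ.* d ℚ.* (c ℚ.- a) ℚ.+ e ℚ.* (a ℚ.* b))))) ≡
    ((e ℚ.+ f) ℚ.- (c ℚ.+ d)) ℚ.* (a ℚ.* b) ℚ.+ (((a ℚ.+ b) ℚ.- (e ℚ.+ f)) ℚ.* (c ℚ.* d) ℚ.+
      ((c ℚ.+ d) ℚ.- (a ℚ.+ b)) ℚ.* (e ℚ.* f))
  D-split = solve 6 (λ a b c d e f →
    ((e :- c :- con 1ℚ) :* d :+ ((d :- b :* b) :+ (b :* (b :- e :- con 1ℚ) :+
        ((b :- con 1ℚ) :+ (e :* (c :- a) :+ a :* b))))) :* f :+
      ((f :- d :* d) :+ (d :* (d :- e :* c) :+ (a :* c :* (d :- b) :+
      (b :* d :* (c :- a) :+ e :* (a :* b))))) :=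
    ((e :+ f) :- (c :+ d)) :* (a :* b) :+ (((a :+ b) :- (e :+ f)) :* (c :* d) :+
      ((c :+ d) :- (a :+ b)) :* (e :* f))) refl
  0<D : 0ℚ ℚ.< D
  0<D = subst (0ℚ ℚ.<_) (D-split a b c d e f)
    (0<+ (0≤* 0≤K-1 (ℚₚ.≤-trans (0≤ 2≤d) (ℚₚ.<⇒≤ d<f)))
    (0<+ (p≤q⇒0≤q-p d²≤f) (0<+ (0≤* (0≤ 2≤d) (p≤q⇒0≤q-p ec≤d))
    (0<+ (0≤* (0≤* (0≤ 2≤a) (0≤ 2≤c)) (p≤q⇒0≤q-p (ℚₚ.<⇒≤ b<d)))
    (0<+ (0≤* (0≤* (0≤ 2≤b) (0≤ 2≤d)) 0≤c-a) (0<* (0< 2≤e) (0<* (0< 2≤a) (0< 2≤b))))))))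
  -- The weights `S₃ - S₂`, `S₁ - S₃`, `S₂ - S₁` sum to 0 and are orthogonal to `(S₁ , S₂ , S₃)`, so
  -- both `y` and `x` cancel.
  eliminate : ∀ S₁ S₂ S₃ p q r x y →
    1ℚ ℚ.* ((S₃ ℚ.- S₂) ℚ.* (y ℚ.- S₁ ℚ.* x ℚ.+ p) ℚ.+ (S₁ ℚ.- S₃) ℚ.* (y ℚ.- S₂ ℚ.* x ℚ.+ q)) ℚ.+
      (S₂ ℚ.- S₁) ℚ.* (y ℚ.- S₃ ℚ.* x ℚ.+ r) ≡
    (S₃ ℚ.- S₂) ℚ.* p ℚ.+ ((S₁ ℚ.- S₃) ℚ.* q ℚ.+ (S₂ ℚ.- S₁) ℚ.* r)
  eliminate = solve 8 (λ S₁ S₂ S₃ p q r x y →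
    con 1ℚ :* ((S₃ :- S₂) :* (y :- S₁ :* x :+ p) :+ (S₁ :- S₃) :* (y :- S₂ :* x :+ q)) :+
      (S₂ :- S₁) :* (y :- S₃ :* x :+ r) :=
    (S₃ :- S₂) :* p :+ ((S₁ :- S₃) :* q :+ (S₂ :- S₁) :* r)) refl
  D≡0 : D ≡ 0ℚ
  D≡0 = null-const (null-combination 1ℚ (S₂ ℚ.- S₁)
    (null-combination (S₃ ℚ.- S₂) (S₁ ℚ.- S₃) ab cd λ n → refl) ef
    λ n → eliminate S₁ S₂ S₃ (a ℚ.* b) (c ℚ.* d) (e ℚ.* f) (seq x n) (seq y n))

-- Chords between points of the parabola with doubly exponential abscissae

abscissa : ℕ → ℚ
abscissa zero    = 2ℚ
abscissa (suc r) = abscissa r ℚ.* abscissa r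

2≤abscissa : ∀ r → 2ℚ ℚ.≤ abscissa r
2≤abscissa zero    = ℚₚ.≤-refl
2≤abscissa (suc r) = ℚₚ.≤-trans (2≤abscissa r) (ℚₚ.<⇒≤ (square-step-< (2≤abscissa r) ℚₚ.≤-refl))

abscissa-mono-≤ : ∀ {r s} → r ≤ s → abscissa r ℚ.≤ abscissa s
abscissa-mono-≤ r≤s = go (ℕₚ.≤⇒≤′ r≤s)
  where
  go : ∀ {r s} → r ℕ.≤′ s → abscissa r ℚ.≤ abscissa s
  go (ℕ.≤′-reflexive refl) = ℚₚ.≤-refl
  go (ℕ.≤′-step {s} r≤s)   =
    ℚₚ.≤-trans (go r≤s) (ℚₚ.<⇒≤ (square-step-< (2≤abscissa s) ℚₚ.≤-refl))

abscissa-square : ∀ {r s} → r < s → abscissa r ℚ.* abscissa r ℚ.≤ abscissa s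
abscissa-square {r} = abscissa-mono-≤ {suc r}

abscissa-mono-< : ∀ {r s} → r < s → abscissa r ℚ.< abscissa s
abscissa-mono-< {r} r<s = square-step-< (2≤abscissa r) (abscissa-square r<s)

abscissa-injective : ∀ {r s} → abscissa r ≡ abscissa s → r ≡ s
abscissa-injective {r} {s} eq = by (ℕₚ.<-cmp r s)
  where
  by : _ → r ≡ s
  by (tri< r<s _ _) = ⊥-elim (ℚₚ.<-irrefl eq (abscissa-mono-< r<s))
  by (tri≈ _ r≡s _) = r≡s
  by (tri> _ _ s<r) = ⊥-elim (ℚₚ.<-irrefl (sym eq) (abscissa-mono-< s<r))

vertex : ℕ → Point
vertex r = parabola (abscissa r)

OnRanks : ℕ → ℕ → Point → Set
OnRanks i j P = OnChord (abscissa i) (abscissa j) P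

Alternate : ℕ → ℕ → ℕ → ℕ → Set
Alternate i j k l = i < k × k < j × j < l

data Meeting (i j k l : ℕ) (P : Point) : Set where
  same      : i ≡ k → j ≡ l → Meeting i j k l P
  common    : ∀ m → m ≡ i ⊎ m ≡ j → m ≡ k ⊎ m ≡ l → P ≈ₚ vertex m → Meeting i j k l P
  alternate : Alternate i j k l → Meeting i j k l P
  alternate′ : Alternate k l i j → Meeting i j k l P

meeting-sym : ∀ {i j k l P} → Meeting k l i j P → Meeting i j k l P
meeting-sym (same p q)         = same (sym p) (sym q)
meeting-sym (common m p q P≈m) = common m q p P≈m
meeting-sym (alternate h)      = alternate′ h
meeting-sym (alternate′ h)     = alternate h

0<difference : ∀ {r s} → r < s → 0ℚ ℚ.< abscissa s ℚ.- abscissa r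
0<difference r<s = p<q⇒0<q-p (abscissa-mono-< r<s)

<⇒abscissa-≢ : ∀ {r s} → r < s → abscissa r ≢ abscissa s
<⇒abscissa-≢ r<s = ℕₚ.<⇒≢ r<s ∘ abscissa-injective

disjoint-ranks : ∀ {i j k l P} → i < j → j < k → k < l → OnRanks i j P → OnRanks k l P → ⊥
disjoint-ranks {i} {j} {k} {l} i<j j<k k<l on on′ = chords-apart 1ℚ
  (positive (abscissa i) (0<difference (ℕₚ.<-trans i<j j<k)) (0<difference (ℕₚ.<-trans i<j (ℕₚ.<-trans j<k k<l))))
  (positive (abscissa j) (0<difference j<k) (0<difference (ℕₚ.<-trans j<k k<l)))
  on (chord⊆line on′)
  where
  open +-*-Solver
  identity : ∀ p c d → (c ℚ.- p) ℚ.* (d ℚ.- p) ≡ 1ℚ ℚ.* ((p ℚ.- c) ℚ.* (p ℚ.- d))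
  identity = solve 3 (λ p c d → (c :- p) :* (d :- p) := con 1ℚ :* ((p :- c) :* (p :- d))) refl
  positive : ∀ p {c d} → 0ℚ ℚ.< c ℚ.- p → 0ℚ ℚ.< d ℚ.- p →
    0ℚ ℚ.< 1ℚ ℚ.* ((p ℚ.- c) ℚ.* (p ℚ.- d))
  positive p {c} {d} h k = subst (0ℚ ℚ.<_) (identity p c d) (0<* h k)

-- Both inner ends lie strictly between `i` and `j`, where the form of the outer line is negative;
-- hence the scale -1 and the exchanged roles of the chords.
nested-ranks : ∀ {i j k l P} → i < k → k < l → l < j → OnRanks i j P → OnRanks k l P → ⊥
nested-ranks {i} {j} {k} {l} i<k k<l l<j on on′ = chords-apart (ℚ.- 1ℚ)
  (positive (abscissa k) (0<difference i<k) (0<difference (ℕₚ.<-trans k<l l<j)))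
  (positive (abscissa l) (0<difference (ℕₚ.<-trans i<k k<l)) (0<difference l<j))
  on′ (chord⊆line on)
  where
  open +-*-Solver
  identity : ∀ p c d → (p ℚ.- c) ℚ.* (d ℚ.- p) ≡ ℚ.- 1ℚ ℚ.* ((p ℚ.- c) ℚ.* (p ℚ.- d))
  identity = solve 3 (λ p c d → (p :- c) :* (d :- p) := con (ℚ.- 1ℚ) :* ((p :- c) :* (p :- d))) refl
  positive : ∀ p {c d} → 0ℚ ℚ.< p ℚ.- c → 0ℚ ℚ.< d ℚ.- p →
    0ℚ ℚ.< ℚ.- 1ℚ ℚ.* ((p ℚ.- c) ℚ.* (p ℚ.- d))
  positive p {c} {d} h k = subst (0ℚ ℚ.<_) (identity p c d) (0<* h k)

meeting : ∀ {i j k l P} → i < j → k < l → OnRanks i j P → OnRanks k l P → Meeting i j k l P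
meeting {i} {j} {k} {l} {P} i<j k<l on on′ = by (ℕₚ.<-cmp i k)
  where
  lowFirst : ∀ {i j k l} → i < k → i < j → k < l → OnRanks i j P → OnRanks k l P → Meeting i j k l P
  lowFirst {i} {j} {k} {l} i<k i<j k<l on on′ = by (ℕₚ.<-cmp k j) (ℕₚ.<-cmp j l)
    where
    by : _ → _ → Meeting i j k l P
    by (tri< k<j _ _) (tri< j<l _ _) = alternate (i<k , k<j , j<l)
    -- `chords-at-common-end` wants the shared end first, hence the reversed chords.
    by (tri< k<j _ _) (tri≈ _ refl _) = common j (inj₂ refl) (inj₂ refl)
      (chords-at-common-end (<⇒abscissa-≢ i<j ∘ sym) (<⇒abscissa-≢ i<k)
        (onChord-sym on) (chord⊆line (onChord-sym on′)))
    by (tri< k<j _ _) (tri> _ _ l<j) = ⊥-elim (nested-ranks i<k k<l l<j on on′)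
    by (tri≈ _ refl _) _ = common j (inj₂ refl) (inj₁ refl)
      (chords-at-common-end (<⇒abscissa-≢ i<j ∘ sym) (<⇒abscissa-≢ (ℕₚ.<-trans i<j k<l))
        (onChord-sym on) (chord⊆line on′))
    by (tri> _ _ j<k) _ = ⊥-elim (disjoint-ranks i<j j<k k<l on on′)
  equalLow : i ≡ k → Meeting i j k l P
  equalLow refl = by (j ℕₚ.≟ l)
    where
    by : _ → Meeting i j k l P
    by (yes j≡l) = same refl j≡l
    by (no j≢l) = common i (inj₁ refl) (inj₁ refl)
      (chords-at-common-end (<⇒abscissa-≢ i<j) (j≢l ∘ abscissa-injective) on (chord⊆line on′))
  by : _ → Meeting i j k l P
  by (tri< i<k _ _) = lowFirst i<k i<j k<l on on′
  by (tri≈ _ i≡k _) = equalLow i≡k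
  by (tri> _ _ k<i) = meeting-sym (lowFirst k<i k<l i<j on′ on)

-- The three alternations together force the order `a < c < e < b < d < f`, for which the
-- determinant is positive.
no-alternating-triple : ∀ {a b c d e f P} → Alternate a b c d → Alternate c d e f → Alternate a b e f →
  OnRanks a b P → OnRanks c d P → OnRanks e f P → ⊥
no-alternating-triple {a} (a<c , _ , b<d) (c<e , _ , d<f) (_ , e<b , _) on₁ on₂ on₃ =
  lines-not-concurrent (2≤abscissa a) (abscissa-square a<c) (abscissa-square c<e)
    (abscissa-square e<b) (abscissa-square b<d) (abscissa-square d<f)
    (chord⊆line on₁) (chord⊆line on₂) (chord⊆line on₃)

-- Of the eight ways to orient the three alternations, six are linear orders of the chords by their
-- lower ends and two are cyclic, which is absurd.
no-crossing-triple : ∀ {a b c d e f P} →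
  Alternate a b c d ⊎ Alternate c d a b → Alternate c d e f ⊎ Alternate e f c d →
  Alternate a b e f ⊎ Alternate e f a b → OnRanks a b P → OnRanks c d P → OnRanks e f P → ⊥
no-crossing-triple (inj₁ ab) (inj₁ bc) (inj₁ ac) A B C = no-alternating-triple ab bc ac A B C
no-crossing-triple (inj₁ ab) (inj₁ bc) (inj₂ ca) A B C =
  ℕₚ.<-irrefl refl (ℕₚ.<-trans (proj₁ ab) (ℕₚ.<-trans (proj₁ bc) (proj₁ ca)))
no-crossing-triple (inj₁ ab) (inj₂ cb) (inj₁ ac) A B C = no-alternating-triple ac cb ab A C B
no-crossing-triple (inj₁ ab) (inj₂ cb) (inj₂ ca) A B C = no-alternating-triple ca ab cb C A B
no-crossing-triple (inj₂ ba) (inj₁ bc) (inj₁ ac) A B C = no-alternating-triple ba ac bc B A C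
no-crossing-triple (inj₂ ba) (inj₁ bc) (inj₂ ca) A B C = no-alternating-triple bc ca ba B C A
no-crossing-triple (inj₂ ba) (inj₂ cb) (inj₁ ac) A B C =
  ℕₚ.<-irrefl refl (ℕₚ.<-trans (proj₁ ac) (ℕₚ.<-trans (proj₁ cb) (proj₁ ba)))
no-crossing-triple (inj₂ ba) (inj₂ cb) (inj₂ ca) A B C = no-alternating-triple cb ba ca C B A

vertex-not-inside : ∀ {i j m P} → P ≈ₚ vertex m → OnRanks i j P → m ≡ i ⊎ m ≡ j
vertex-not-inside P≈m on =
  [ inj₁ ∘ abscissa-injective , inj₂ ∘ abscissa-injective ]′ (parabola∩line P≈m (chord⊆line on))

vertex-distinct : ∀ {i j} → vertex i ≈ₚ vertex j → i ≡ j
vertex-distinct = abscissa-injective ∘ fromℚ-injective ∘ proj₁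

-- A Vandermonde argument by divided differences: `a z + b z² - c` is null at three distinct
-- abscissae, so `a + (p + q) b` and `a + (p + r) b` are null, then `b`, then `a`, against
-- `nonzero`.
parabola-no-three-collinear : ∀ {p q r} → p ≢ q → q ≢ r → p ≢ r →
  ¬ Collinear (parabola p) (parabola q) (parabola r)
parabola-no-three-collinear {p} {q} {r} p≢q q≢r p≢r (ℓ , onP , onQ , onR) =
  nonzero (null⇒≈ {a} {0ᵣ} (null-cong (λ n → e₄ (seq a n)) a-null) ,
           null⇒≈ {b} {0ᵣ} (null-cong (λ n → e₄ (seq b n)) b-null))
  where
  open Line ℓ
  open +-*-Solver
  N : ℚ → ℕ → ℚ
  N z n = (seq a n ℚ.* z ℚ.+ seq b n ℚ.* (z ℚ.* z)) ℚ.- seq c n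
  null-at : ∀ z → OnLine ℓ (parabola z) → Null (N z)
  null-at z = ≈⇒null {a *ᵣ fromℚ z +ᵣ b *ᵣ fromℚ (z ℚ.* z)} {c}
  e₁ : ∀ a b c p q →
    1ℚ ℚ.* ((a ℚ.* p ℚ.+ b ℚ.* (p ℚ.* p)) ℚ.- c) ℚ.+ ℚ.- 1ℚ ℚ.* ((a ℚ.* q ℚ.+ b ℚ.* (q ℚ.* q)) ℚ.- c) ≡
    (p ℚ.- q) ℚ.* (a ℚ.+ (p ℚ.+ q) ℚ.* b)
  e₁ = solve 5 (λ a b c p q →
    con 1ℚ :* ((a :* p :+ b :* (p :* p)) :- c) :+ con (ℚ.- 1ℚ) :* ((a :* q :+ b :* (q :* q)) :- c) :=
    (p :- q) :* (a :+ (p :+ q) :* b)) refl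
  slope : ∀ {z} → p ≢ z → Null (N z) → Null (λ n → seq a n ℚ.+ (p ℚ.+ z) ℚ.* seq b n)
  slope {z} p≢z h = null-cancel (p ℚ.- z) (p≢q⇒p-q≢0 p≢z)
    (null-combination 1ℚ (ℚ.- 1ℚ) (null-at p onP) h λ n → e₁ (seq a n) (seq b n) (seq c n) p z)
  e₂ : ∀ a b p q r → 1ℚ ℚ.* (a ℚ.+ (p ℚ.+ q) ℚ.* b) ℚ.+ ℚ.- 1ℚ ℚ.* (a ℚ.+ (p ℚ.+ r) ℚ.* b) ≡
    (q ℚ.- r) ℚ.* b
  e₂ = solve 5 (λ a b p q r →
    con 1ℚ :* (a :+ (p :+ q) :* b) :+ con (ℚ.- 1ℚ) :* (a :+ (p :+ r) :* b) := (q :- r) :* b) refl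
  b-null : Null (seq b)
  b-null = null-cancel (q ℚ.- r) (p≢q⇒p-q≢0 q≢r)
    (null-combination 1ℚ (ℚ.- 1ℚ) (slope p≢q (null-at q onQ)) (slope p≢r (null-at r onR))
      λ n → e₂ (seq a n) (seq b n) p q r)
  e₃ : ∀ a b s → 1ℚ ℚ.* (a ℚ.+ s ℚ.* b) ℚ.+ ℚ.- s ℚ.* b ≡ a
  e₃ = solve 3 (λ a b s → con 1ℚ :* (a :+ s :* b) :+ :- s :* b := a) refl
  a-null : Null (seq a)
  a-null = null-combination 1ℚ (ℚ.- (p ℚ.+ q)) (slope p≢q (null-at q onQ)) b-null
    λ n → e₃ (seq a n) (seq b n) (p ℚ.+ q)
  e₄ : ∀ z → z ≡ z ℚ.- 0ℚ
  e₄ = solve 1 (λ z → z := z :- con 0ℚ) refl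

-- Drawings on the parabola with prescribed ranks

module ParabolaDrawing {n} (rank : Fin n → ℕ)
  (rank-injective : ∀ {u v} → rank u ≡ rank v → u ≡ v) where

  pos : Fin n → Point
  pos v = vertex (rank v)

  orientBy : (e : Pair n) → Dec (rank (proj₁ e) < rank (proj₂ e)) → Pair n
  orientBy e (yes _) = e
  orientBy e (no _)  = swap e

  -- `Ordered` selects a representative of an unordered pair by vertex index, while alternation is a
  -- matter of ranks, which may order the ends the other way.
  orient : Pair n → Pair n
  orient e = orientBy e (rank (proj₁ e) ℕₚ.<? rank (proj₂ e))

  orient-cases : ∀ e → orient e ≡ e ⊎ orient e ≡ swap e
  orient-cases e with rank (proj₁ e) ℕₚ.<? rank (proj₂ e)
  ... | yes _ = inj₁ refl
  ... | no _  = inj₂ refl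

  Increasing : Pair n → Set
  Increasing (u , v) = rank u < rank v

  orient-increasing : ∀ e → Ordered e → Increasing (orient e)
  orient-increasing e@(u , v) u<v with rank u ℕₚ.<? rank v
  ... | yes r = r
  ... | no r≮ = ℕₚ.≤∧≢⇒< (ℕₚ.≮⇒≥ r≮) λ eq → Finₚ.<-irrefl (sym (rank-injective eq)) u<v

  ∈ₑ-swap : ∀ {w} (e : Pair n) → w ∈ₑ swap e → w ∈ₑ e
  ∈ₑ-swap e = [ inj₂ , inj₁ ]′

  orient-∈ₑ : ∀ {w} e → w ∈ₑ orient e → w ∈ₑ e
  orient-∈ₑ {w} e w∈ = [ (λ eq → subst (w ∈ₑ_) eq w∈) , (λ eq → ∈ₑ-swap e (subst (w ∈ₑ_) eq w∈)) ]′
    (orient-cases e)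

  OnOriented : Pair n → Point → Set
  OnOriented (u , v) P = OnRanks (rank u) (rank v) P

  orient-on : ∀ e {P} → OnPair pos e P → OnOriented (orient e) P
  orient-on e {P} on = [ (λ eq → subst (λ e → OnOriented e P) (sym eq) (toChord on)) ,
                         (λ eq → subst (λ e → OnOriented e P) (sym eq) (onChord-sym (toChord on))) ]′
    (orient-cases e)

  orient-on⁻¹ : ∀ e {P} → OnOriented (orient e) P → OnPair pos e P
  orient-on⁻¹ e {P} on = [ (λ eq → fromChord {P = P} (subst (λ e → OnOriented e P) eq on)) ,
                           (λ eq → fromChord {P = P} (onChord-sym (subst (λ e → OnOriented e P) eq on))) ]′
    (orient-cases e)

  orient-injective : ∀ {e f} → Ordered e → Ordered f → orient e ≡ orient f → e ≡ f
  orient-injective {e} {f} e< f< eq = by (orient-cases e) (orient-cases f)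
    where
    by : _ → _ → e ≡ f
    by (inj₁ p) (inj₁ q) = trans (sym p) (trans eq q)
    by (inj₁ p) (inj₂ q) = ⊥-elim (Finₚ.<-asym f< (subst Ordered (trans (sym p) (trans eq q)) e<))
    by (inj₂ p) (inj₁ q) = ⊥-elim (Finₚ.<-asym e< (subst Ordered (sym (trans (sym p) (trans eq q))) f<))
    by (inj₂ p) (inj₂ q) = cong swap (trans (sym p) (trans eq q))

  AlternatePairs : Pair n → Pair n → Set
  AlternatePairs (a , b) (c , d) = Alternate (rank a) (rank b) (rank c) (rank d)

  vertexOfRank : ∀ {m} (e : Pair n) → m ≡ rank (proj₁ (orient e)) ⊎ m ≡ rank (proj₂ (orient e)) →
    ∃ λ w → w ∈ₑ e × m ≡ rank w
  vertexOfRank e (inj₁ eq) = proj₁ (orient e) , orient-∈ₑ e (inj₁ refl) , eq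
  vertexOfRank e (inj₂ eq) = proj₂ (orient e) , orient-∈ₑ e (inj₂ refl) , eq

  pairs-meet : ∀ {e f P} → Ordered e → Ordered f → e ≢ f → OnPair pos e P → OnPair pos f P →
    (∃ λ w → w ∈ₑ e × w ∈ₑ f × P ≈ₚ pos w) ⊎
    (AlternatePairs (orient e) (orient f) ⊎ AlternatePairs (orient f) (orient e))
  pairs-meet {e} {f} {P} e< f< e≢f on on′ =
    by (meeting (orient-increasing e e<) (orient-increasing f f<)
         (orient-on e {P} on) (orient-on f {P} on′))
    where
    by : Meeting (rank (proj₁ (orient e))) (rank (proj₂ (orient e)))
                 (rank (proj₁ (orient f))) (rank (proj₂ (orient f))) P → _
    by (same p q) = ⊥-elim (e≢f (orient-injective e< f< (cong₂ _,_ (rank-injective p) (rank-injective q))))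
    by (common m m∈e m∈f P≈m) =
      let (w , w∈e , m≡w) = vertexOfRank e m∈e
          (w′ , w′∈f , m≡w′) = vertexOfRank f m∈f
      in inj₁ (w , w∈e , subst (_∈ₑ f) (rank-injective (trans (sym m≡w′) m≡w)) w′∈f ,
               subst (λ m → P ≈ₚ vertex m) m≡w P≈m)
    by (alternate h)  = inj₂ (inj₁ h)
    by (alternate′ h) = inj₂ (inj₂ h)

  on-pair-at-vertex : ∀ {w P} e → P ≈ₚ pos w → OnPair pos e P → w ∈ₑ e
  on-pair-at-vertex {w} {P} e P≈w on =
    let (w′ , w′∈e , eq) = vertexOfRank e (vertex-not-inside P≈w (orient-on e {P} on))
    in subst (_∈ₑ e) (sym (rank-injective eq)) w′∈e

  -- If two of the pairs meet at a shared vertex, `P` is that vertex, and the third pair can pass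
  -- through it only by having it as an end. Otherwise all three alternate pairwise.
  concurrent : ∀ e f g → Ordered e → Ordered f → Ordered g → e ≢ f → f ≢ g → e ≢ g →
    ∀ P → OnPair pos e P → OnPair pos f P → OnPair pos g P →
    ∃ λ v → v ∈ₑ e × v ∈ₑ f × v ∈ₑ g
  concurrent e f g e< f< g< e≢f f≢g e≢g P one onf ong =
    by (pairs-meet {P = P} e< f< e≢f one onf) (pairs-meet {P = P} f< g< f≢g onf ong)
       (pairs-meet {P = P} e< g< e≢g one ong)
    where
    by : _ → _ → _ → _
    by (inj₁ (w , w∈e , w∈f , P≈w)) _ _ = w , w∈e , w∈f , on-pair-at-vertex {P = P} g P≈w ong
    by (inj₂ _) (inj₁ (w , w∈f , w∈g , P≈w)) _ = w , on-pair-at-vertex {P = P} e P≈w one , w∈f , w∈g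
    by (inj₂ _) (inj₂ _) (inj₁ (w , w∈e , w∈g , P≈w)) =
      w , w∈e , on-pair-at-vertex {P = P} f P≈w onf , w∈g
    by (inj₂ ef) (inj₂ fg) (inj₂ eg) = ⊥-elim (no-crossing-triple ef fg eg
      (orient-on e {P} one) (orient-on f {P} onf) (orient-on g {P} ong))

  generalPosition : GeneralPosition pos
  generalPosition = record
    { distinct = λ u v u≢v eq → u≢v (rank-injective (vertex-distinct eq))
    ; no-three-collinear = λ u v w u≢v v≢w u≢w → parabola-no-three-collinear
        (u≢v ∘ rank-injective ∘ abscissa-injective) (v≢w ∘ rank-injective ∘ abscissa-injective)
        (u≢w ∘ rank-injective ∘ abscissa-injective)
    ; no-three-concurrent = concurrent
    }

  drawing : (G : Graph n) → RectilinearDrawing G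
  drawing G = record { pos = pos ; generalPosition = generalPosition }

-- Depth-first orders of trees

IsFirst : ∀ {m} → (Fin m → ℕ) → (Fin m → Set) → Fin m → Set
IsFirst o Y y = Y y × ∀ s → Y s → o y ≤ o s

Meets : ∀ {m} → (Fin m → Set) → (Fin m → Set) → Set
Meets Y X = ∃ λ s → Y s × X s

module _ {m} (T : Graph m) where
  open Graph T
  open DecMembership (Finₚ._≟_ {m}) using (_∈?_)

  Within : (Fin m → Set) → Fin m → Fin m → Set
  Within Y s t = s ~ t × Y s × Y t

  ConnectedSet : (Fin m → Set) → Set
  ConnectedSet Y = ∀ s t → Y s → Y t → Star (Within Y) s t

  -- If Y, X and Q, V are the subtrees of two edges whose ends come in the order Y, Q, X, V,
  -- then the first node of Q lies in Y.
  Separating : (Fin m → Set) → (Fin m → ℕ) → Set₁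
  Separating L o = ∀ {Y X Q V : Fin m → Set} {y x q v} →
    (∀ {s} → Y s → L s) → (∀ {s} → X s → L s) → (∀ {s} → Q s → L s) → (∀ {s} → V s → L s) →
    ConnectedSet Y → ConnectedSet X → ConnectedSet Q → ConnectedSet V →
    IsFirst o Y y → IsFirst o X x → IsFirst o Q q → IsFirst o V v →
    Meets Y X → Meets Q V →
    o y ≤ o q → o q ≤ o x → o x ≤ o v → Y q

  data Path : Fin m → Fin m → List (Fin m) → Set where
    end  : ∀ {t} → Path t t (t ∷ [])
    step : ∀ {s s′ t xs} → s ~ s′ → s ∉ xs → Path s′ t xs → Path s t (s ∷ xs)

  path-suffix : ∀ {s s′ t xs} → s ∈ xs → Path s′ t xs → ∃ λ ys → Path s t ys × (∀ {z} → z ∈ ys → z ∈ xs)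
  path-suffix (here refl) end = _ , end , id
  path-suffix (here refl) p@(step _ _ _) = _ , p , id
  path-suffix (there s∈) (step _ _ p) =
    let (ys , q , ⊆) = path-suffix s∈ p in ys , q , there ∘ ⊆

  loop-erase : ∀ {L s t} → L s → Star (Within L) s t → ∃ λ xs → Path s t xs × (∀ {z} → z ∈ xs → L z)
  loop-erase Ls ε⋆ = _ , end , λ { (here refl) → Ls }
  loop-erase {s = s} Ls ((s~s′ , _ , Ls′) ◅ w) with loop-erase Ls′ w
  ... | xs , p , ⊆ with s ∈? xs
  ...   | yes s∈ = let (ys , q , ⊆′) = path-suffix s∈ p in ys , q , ⊆ ∘ ⊆′
  ...   | no s∉  = s ∷ xs , step s~s′ s∉ p , λ { (here refl) → Ls ; (there z∈) → ⊆ z∈ }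

  path-unique : ∀ {s t xs} → Path s t xs → Unique xs
  path-unique end            = [] ∷ []
  path-unique (step _ s∉ p) = Allₚ.¬Any⇒All¬ _ s∉ ∷ path-unique p

  path-linked : ∀ {b c s t xs} → b ~ s → Path s t xs → t ~ c → Linked _~_ (b ∷ xs ++ c ∷ [])
  path-linked b~s end             t~c = b~s ∷ t~c ∷ [-]
  path-linked b~s (step s~s′ _ p) t~c = b~s ∷ path-linked s~s′ p t~c

  path-long : ∀ {s t xs} → s ≢ t → Path s t xs → 2 ≤ length xs
  path-long s≢t end                       = ⊥-elim (s≢t refl)
  path-long s≢t (step _ _ end)            = s≤s (s≤s z≤n)
  path-long s≢t (step _ _ (step _ _ _)) = s≤s (s≤s z≤n)

  record DepthFirst (L : List (Fin m)) : Set₁ where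
    field
      o           : Fin m → ℕ
      o-injective : ∀ {s t} → s ∈ L → t ∈ L → o s ≡ o t → s ≡ t
      connected   : ConnectedSet (_∈ L)
      separating  : Separating (_∈ L) o

  singleton : ∀ r → DepthFirst (r ∷ [])
  singleton r = record
    { o = λ _ → 0
    ; o-injective = λ { (here refl) (here refl) _ → refl }
    ; connected = λ { _ _ (here refl) (here refl) → ε⋆ }
    ; separating = λ {Y} Y⊆ _ Q⊆ _ _ _ _ _ (Yy , _) _ (Qq , _) _ _ _ _ _ _ →
        subst Y (equal (Y⊆ Yy) (Q⊆ Qq)) Yy
    }
    where
    equal : ∀ {s t} → s ∈ r ∷ [] → t ∈ r ∷ [] → s ≡ t
    equal (here refl) (here refl) = refl

  -- A new leaf is inserted immediately after its parent; contracting it back onto the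
  -- parent carries connected sets and their first nodes to such.
  module AddLeaf (acyclic : Acyclic T) {L p c} (D : DepthFirst L)
    (p∈L : p ∈ L) (c∉L : c ∉ L) (p~c : p ~ c) where
    open DepthFirst D

    -- A second neighbour of `c` in `L` would be joined to `p` by a path inside `L`, which `c`
    -- closes to a cycle.
    only-neighbour : ∀ {z} → z ∈ L → c ~ z → z ≡ p
    only-neighbour {z} z∈L c~z with z Finₚ.≟ p
    ... | yes z≡p = z≡p
    ... | no z≢p =
      let (xs , path , ⊆) = loop-erase z∈L (connected z p z∈L p∈L)
      in ⊥-elim (acyclic c xs (path-long z≢p path ,
           Allₚ.¬Any⇒All¬ _ (c∉L ∘ ⊆) ∷ path-unique path , path-linked c~z path p~c))

    contract : Fin m → Fin m
    contract s with s Finₚ.≟ c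
    ... | yes _ = p
    ... | no _  = s

    bit : Fin m → ℕ
    bit s with s Finₚ.≟ c
    ... | yes _ = 1
    ... | no _  = 0

    contract-c : contract c ≡ p
    contract-c with c Finₚ.≟ c
    ... | yes _ = refl
    ... | no c≢c = ⊥-elim (c≢c refl)

    bit-c : bit c ≡ 1
    bit-c with c Finₚ.≟ c
    ... | yes _ = refl
    ... | no c≢c = ⊥-elim (c≢c refl)

    contract-≢ : ∀ {s} → s ≢ c → contract s ≡ s
    contract-≢ {s} s≢c with s Finₚ.≟ c
    ... | yes s≡c = ⊥-elim (s≢c s≡c)
    ... | no _ = refl

    bit-≢ : ∀ {s} → s ≢ c → bit s ≡ 0
    bit-≢ {s} s≢c with s Finₚ.≟ c
    ... | yes s≡c = ⊥-elim (s≢c s≡c)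
    ... | no _ = refl

    bit≤1 : ∀ s → bit s ≤ 1
    bit≤1 s with s Finₚ.≟ c
    ... | yes _ = s≤s z≤n
    ... | no _  = z≤n

    -- Doubling frees the odd numbers: nodes other than `c` get even values, and `c` gets the odd
    -- value just above that of `p`.
    o′ : Fin m → ℕ
    o′ s = bit s + 2 * o (contract s)

    -- `o (contract s)` is half of `o′ s`, rounded down.
    o′-mono : ∀ {s t} → o′ s ≤ o′ t → o (contract s) ≤ o (contract t)
    o′-mono {s} {t} h = ℕₚ.≮⇒≥ λ t<s → ℕₚ.<-irrefl refl (begin-strict
      1 + 2 * o (contract t)       <⟨ ℕₚ.n<1+n _ ⟩
      2 + 2 * o (contract t)       ≡⟨ ℕₚ.*-suc 2 (o (contract t)) ⟨
      2 * suc (o (contract t))     ≤⟨ ℕₚ.*-monoʳ-≤ 2 t<s ⟩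
      2 * o (contract s)           ≤⟨ ℕₚ.m≤n+m _ (bit s) ⟩
      o′ s                         ≤⟨ h ⟩
      bit t + 2 * o (contract t)   ≤⟨ ℕₚ.+-monoˡ-≤ _ (bit≤1 t) ⟩
      1 + 2 * o (contract t)       ∎)
      where open ℕₚ.≤-Reasoning

    p≢c : p ≢ c
    p≢c refl = c∉L p∈L

    ∈-tail : ∀ {s} → s ≢ c → s ∈ c ∷ L → s ∈ L
    ∈-tail s≢c (here s≡c) = ⊥-elim (s≢c s≡c)
    ∈-tail s≢c (there s∈) = s∈

    contract-∈ : ∀ {s} → s ∈ c ∷ L → contract s ∈ L
    contract-∈ {s} s∈ with s Finₚ.≟ c
    ... | yes _ = p∈L
    ... | no s≢c = ∈-tail s≢c s∈

    o′p<o′c : o′ p < o′ c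
    o′p<o′c = ℕₚ.≤-reflexive (trans
      (cong₂ (λ b s → suc (b + 2 * o s)) (bit-≢ p≢c) (contract-≢ p≢c))
      (sym (cong₂ (λ b s → b + 2 * o s) bit-c contract-c)))

    o′-injective : ∀ {s t} → s ∈ c ∷ L → t ∈ c ∷ L → o′ s ≡ o′ t → s ≡ t
    o′-injective {s} {t} s∈ t∈ eq with s Finₚ.≟ c | t Finₚ.≟ c
    ... | yes refl | yes refl = refl
    ... | no s≢c | no t≢c = o-injective (∈-tail s≢c s∈) (∈-tail t≢c t∈) (ℕₚ.*-cancelˡ-≡ _ _ 2 eq)
    ... | yes _ | no _ = ⊥-elim (ℕₚ.even≢odd (o t) (o p) (sym eq))
    ... | no _ | yes _ = ⊥-elim (ℕₚ.even≢odd (o s) (o p) eq)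

    connected′ : ConnectedSet (_∈ c ∷ L)
    connected′ s t = go
      where
      lift : ∀ {s t} → Star (Within (_∈ L)) s t → Star (Within (_∈ c ∷ L)) s t
      lift ε⋆ = ε⋆
      lift ((s~t , s∈ , t∈) ◅ w) = (s~t , there s∈ , there t∈) ◅ lift w
      go : ∀ {s t} → s ∈ c ∷ L → t ∈ c ∷ L → Star (Within (_∈ c ∷ L)) s t
      go (here refl) (here refl) = ε⋆
      go (here refl) (there t∈) = (symm p~c , here refl , there p∈L) ◅ lift (connected _ _ p∈L t∈)
      go (there s∈) (here refl) = lift (connected _ _ s∈ p∈L) ◅◅ (p~c , there p∈L , here refl) ◅ ε⋆
      go (there s∈) (there t∈) = lift (connected _ _ s∈ t∈)

    Image : (Fin m → Set) → Fin m → Set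
    Image Y s = ∃ λ t → Y t × contract t ≡ s

    image-⊆ : ∀ {Y} → (∀ {s} → Y s → s ∈ c ∷ L) → ∀ {s} → Image Y s → s ∈ L
    image-⊆ Y⊆ (t , Yt , refl) = contract-∈ (Y⊆ Yt)

    image-first : ∀ {Y y} → IsFirst o′ Y y → IsFirst o (Image Y) (contract y)
    image-first {y = y} (Yy , least) = (_ , Yy , refl) , λ { _ (t , Yt , refl) → o′-mono {y} {t} (least t Yt) }

    image-meets : ∀ {Y X} → Meets Y X → Meets (Image Y) (Image X)
    image-meets (s , Ys , Xs) = contract s , (s , Ys , refl) , (s , Xs , refl)

    image-connected : ∀ {Y} → (∀ {s} → Y s → s ∈ c ∷ L) → ConnectedSet Y → ConnectedSet (Image Y)
    image-connected {Y} Y⊆ conn _ _ (s , Ys , refl) (t , Yt , refl) = go (conn s t Ys Yt)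
      where
      edge : ∀ {s t} → Within Y s t → Star (Within (Image Y)) (contract s) (contract t)
      edge {s} {t} (s~t , Ys , Yt) with s Finₚ.≟ c | t Finₚ.≟ c
      ... | yes refl | yes refl = ε⋆
      -- The only edge at the leaf leads to `p` and contracts to the empty walk.
      ... | yes refl | no t≢c   = subst (Star _ p) (sym (only-neighbour (∈-tail t≢c (Y⊆ Yt)) s~t)) ε⋆
      ... | no s≢c   | yes refl = subst (λ z → Star _ z p) (sym (only-neighbour (∈-tail s≢c (Y⊆ Ys)) (symm s~t))) ε⋆
      ... | no s≢c   | no t≢c   = (s~t , (s , Ys , contract-≢ s≢c) , (t , Yt , contract-≢ t≢c)) ◅ ε⋆
      go : ∀ {s t} → Star (Within Y) s t → Star (Within (Image Y)) (contract s) (contract t)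
      go ε⋆ = ε⋆
      go (e ◅ w) = edge e ◅◅ go w

    -- A walk inside `Y` from `c` to another node has to leave along the edge to `p`.
    contains-parent : ∀ {Y t} → (∀ {s} → Y s → s ∈ c ∷ L) → ConnectedSet Y → Y c → Y t → t ≢ c → Y p
    contains-parent {Y} {t} Y⊆ conn Yc Yt t≢c with conn c t Yc Yt
    ... | ε⋆ = ⊥-elim (t≢c refl)
    ... | _◅_ {j = z} (c~z , _ , Yz) _ =
      subst Y (only-neighbour (∈-tail (λ z≡c → irrefl (sym z≡c) c~z) (Y⊆ Yz)) c~z) Yz

    -- Any further node would bring `p` into `Y`, and `p` precedes `c`.
    first-c : ∀ {Y t} → (∀ {s} → Y s → s ∈ c ∷ L) → ConnectedSet Y → IsFirst o′ Y c → Y t → t ≡ c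
    first-c {Y} {t} Y⊆ conn (Yc , least) Yt with t Finₚ.≟ c
    ... | yes t≡c = t≡c
    ... | no t≢c = ⊥-elim (ℕₚ.<⇒≱ o′p<o′c (least p (contains-parent Y⊆ conn Yc Yt t≢c)))

    separating′ : Separating (_∈ c ∷ L) o′
    separating′ {Y} {X} {Q} {V} {y} {x} {q} {v} Y⊆ X⊆ Q⊆ V⊆ cY cX cQ cV fY fX fQ fV YX QV y≤q q≤x x≤v =
      by (q Finₚ.≟ c)
      where
      -- Here `Q` is the leaf alone, so `V` contains `c` and `o′ c ≤ o′ x ≤ o′ v ≤ o′ c`. Thus
      -- `x = c`, so `X` is the leaf alone as well, and `Y` meets it there.
      q-is-leaf : q ≡ c → Y q
      q-is-leaf refl = subst Y YX≡c (proj₁ (proj₂ YX))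
        where
        QV≡c : proj₁ QV ≡ c
        QV≡c = first-c Q⊆ cQ fQ (proj₁ (proj₂ QV))
        x≡c : x ≡ c
        x≡c = o′-injective (X⊆ (proj₁ fX)) (here refl) (ℕₚ.≤-antisym
          (ℕₚ.≤-trans x≤v (proj₂ fV c (subst V QV≡c (proj₂ (proj₂ QV))))) q≤x)
        YX≡c : proj₁ YX ≡ c
        YX≡c = first-c X⊆ cX (subst (IsFirst o′ X) x≡c fX) (proj₂ (proj₂ YX))
      image-at-q : Image Y (contract q)
      image-at-q = separating (image-⊆ Y⊆) (image-⊆ X⊆) (image-⊆ Q⊆) (image-⊆ V⊆)
        (image-connected Y⊆ cY) (image-connected X⊆ cX) (image-connected Q⊆ cQ) (image-connected V⊆ cV)
        (image-first fY) (image-first fX) (image-first fQ) (image-first fV)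
        (image-meets YX) (image-meets QV)
        (o′-mono {y} {q} y≤q) (o′-mono {q} {x} q≤x) (o′-mono {x} {v} x≤v)
      -- Contraction identifies `c` with `p` only. If the witness in `Y` is `c`, then `q = p`; as
      -- `y` does not come after `p`, it differs from `c`, so `Y` reaches beyond the leaf and
      -- contains `p`.
      lift-image : q ≢ c → ∀ t → Y t → contract t ≡ q → Dec (t ≡ c) → Y q
      lift-image q≢c t Yt t↦q (no t≢c)  = subst Y (trans (sym (contract-≢ t≢c)) t↦q) Yt
      lift-image q≢c t Yc t↦q (yes refl) = subst Y p≡q (contains-parent Y⊆ cY Yc (proj₁ fY) y≢c)
        where
        p≡q : p ≡ q
        p≡q = trans (sym contract-c) t↦q
        y≢c : y ≢ c
        y≢c refl = ℕₚ.<⇒≱ o′p<o′c (subst (λ z → o′ c ≤ o′ z) (sym p≡q) y≤q)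
      by : Dec (q ≡ c) → Y q
      by (yes q≡c) = q-is-leaf q≡c
      by (no q≢c)  = let (t , Yt , t↦) = image-at-q in
        lift-image q≢c t Yt (trans t↦ (contract-≢ q≢c)) (t Finₚ.≟ c)

    addLeaf : DepthFirst (c ∷ L)
    addLeaf = record
      { o = o′ ; o-injective = o′-injective ; connected = connected′ ; separating = separating′ }

  module _ (acyclic : Acyclic T) where

    -- Along the walk, each node outside `L` has its predecessor in `L` and is hung onto it as a new
    -- leaf.
    extend : ∀ {L s t} → DepthFirst L → s ∈ L → Star _~_ s t →
      Σ (List (Fin m)) λ L′ → DepthFirst L′ × (∀ {z} → z ∈ L → z ∈ L′) × t ∈ L′
    extend D s∈ ε⋆ = _ , D , id , s∈
    extend {L} D s∈ (_◅_ {j = s′} s~s′ w) with s′ ∈? L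
    ... | yes s′∈ = extend D s′∈ w
    ... | no s′∉ =
      let (L′ , D′ , ⊆ , t∈) = extend (AddLeaf.addLeaf acyclic D s∈ s′∉ s~s′) (here refl) w
      in L′ , D′ , ⊆ ∘ there , t∈

    extend-all : ∀ {L r} → Connected T → DepthFirst L → r ∈ L → ∀ ts →
      Σ (List (Fin m)) λ L′ → DepthFirst L′ × (∀ {z} → z ∈ L → z ∈ L′) × All (_∈ L′) ts
    extend-all conn D r∈ [] = _ , D , id , []
    extend-all {r = r} conn D r∈ (t ∷ ts) =
      let (L₁ , D₁ , ⊆₁ , t∈) = extend D r∈ (conn r t)
          (L₂ , D₂ , ⊆₂ , ts∈) = extend-all conn D₁ (⊆₁ r∈) ts
      in L₂ , D₂ , ⊆₂ ∘ ⊆₁ , ⊆₂ t∈ ∷ ts∈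

  depthFirst : IsTree T → Σ (List (Fin m)) λ L → DepthFirst L × (∀ s → s ∈ L)
  depthFirst (1≤m , conn , acyclic) =
    let r = Fin.fromℕ< 1≤m
        (L , D , _ , all) = extend-all acyclic conn (singleton r) (here refl) (allFin m)
    in L , D , λ s → All.lookup all (∈-allFin s)

-- Counting the crossings

length-concatMap : ∀ {A B : Set} {f : A → List B} {b} xs →
  (∀ x → length (f x) ≤ b) → length (concatMap f xs) ≤ length xs * b
length-concatMap []       bound = z≤n
length-concatMap {f = f} (x ∷ xs) bound = ℕₚ.≤-trans
  (ℕₚ.≤-reflexive (Listₚ.length-++ (f x))) (ℕₚ.+-mono-≤ (bound x) (length-concatMap xs bound))

length-deduplicate : ∀ {A : Set} (_≟_ : ∀ (x y : A) → Dec (x ≡ y)) xs →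
  length (deduplicate _≟_ xs) ≤ length xs
length-deduplicate _≟_ []       = z≤n
length-deduplicate _≟_ (x ∷ xs) =
  s≤s (ℕₚ.≤-trans (Listₚ.length-filter _ (deduplicate _≟_ xs)) (length-deduplicate _≟_ xs))

elements : ∀ {n} → Subset n → List (Fin n)
elements []                  = []
elements (Subset.inside ∷ p)  = Fin.zero ∷ map Fin.suc (elements p)
elements (Subset.outside ∷ p) = map Fin.suc (elements p)

length-elements : ∀ {n} (p : Subset n) → length (elements p) ≡ ∣ p ∣
length-elements []                  = refl
length-elements (Subset.inside ∷ p)  =
  cong suc (trans (Listₚ.length-map Fin.suc (elements p)) (length-elements p))
length-elements (Subset.outside ∷ p) =
  trans (Listₚ.length-map Fin.suc (elements p)) (length-elements p)

∈-elements : ∀ {n} {p : Subset n} {x} → x ∈ₛ p → x ∈ elements p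
∈-elements {p = Subset.inside ∷ p}  Vec.here       = here refl
∈-elements {p = Subset.inside ∷ p}  (Vec.there x∈) = there (∈-map⁺ Fin.suc (∈-elements x∈))
∈-elements {p = Subset.outside ∷ p} (Vec.there x∈) = ∈-map⁺ Fin.suc (∈-elements x∈)

degree≤Δ : ∀ {n} (G : Graph n) v → degree G v ≤ Δ G
degree≤Δ {n} G v = All.lookup (xs≤max 0 (map (degree G) (allFin n))) (∈-map⁺ (degree G) (∈-allFin v))

onSegment-resp : ∀ {A B P Q} → P ≈ₚ Q → OnSegment A B Q → OnSegment A B P
onSegment-resp {ax , ay} {bx , by} {x , y} {x′ , y′} (x≈ , y≈) (t , 0≤t , t≤1 , hx , hy) =
  t , 0≤t , t≤1 ,
  ≈-trans {x} {x′} {(1ᵣ -ᵣ t) *ᵣ ax +ᵣ t *ᵣ bx} x≈ hx ,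
  ≈-trans {y} {y′} {(1ᵣ -ᵣ t) *ᵣ ay +ᵣ t *ᵣ by} y≈ hy

module SeparatedRanking {n} (G : Graph n) (rank : Fin n → ℕ)
  (rank-injective : ∀ {u v} → rank u ≡ rank v → u ≡ v)
  (separator : Fin n → Subset n)
  (separates : ∀ {a b c d} → Graph._~_ G a b → Graph._~_ G c d →
    Alternate (rank a) (rank b) (rank c) (rank d) → a ∈ₛ separator c)
  where

  open Graph G
  open ParabolaDrawing rank rank-injective
  open RectilinearDrawing (drawing G) using (IsCrossing; HasCrossings)
  open MembershipSetoid planeSetoid using () renaming (_∈_ to _∈ₚ_)

  edges : List (Pair n)
  edges = filter (isEdge? G) (cartesianProduct (allFin n) (allFin n))

  neighbours : Fin n → List (Fin n)
  neighbours v = filter (v ~?_) (allFin n)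

  crossedFrom : Pair n → Fin n → List (Pair n × Pair n)
  crossedFrom e a = map (λ b → (a , b) , orient e) (neighbours a)

  -- Here `e` plays the later edge `cd`: all edges `ab` with `a` in the separator of `c` are listed,
  -- crossing or not. The bound is proved for this longer list, and the later filtering and removal
  -- of duplicates only shorten it.
  crossedBy : Pair n → List (Pair n × Pair n)
  crossedBy e = concatMap (crossedFrom e) (elements (separator (proj₁ (orient e))))

  candidates : List (Pair n × Pair n)
  candidates = concatMap crossedBy edges

  alternatePairs? : Decidable {A = Pair n × Pair n} λ (e , f) → AlternatePairs e f
  alternatePairs? ((a , b) , (c , d)) =
    (rank a ℕₚ.<? rank c) ×-dec ((rank c ℕₚ.<? rank b) ×-dec (rank b ℕₚ.<? rank d))

  intersection : Pair n × Pair n → ℚ × ℚ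
  intersection ((a , b) , (c , d)) =
    crossing (abscissa (rank a)) (abscissa (rank b)) (abscissa (rank c)) (abscissa (rank d))

  _≟ℚ²_ : (p q : ℚ × ℚ) → Dec (p ≡ q)
  _≟ℚ²_ = ≡-dec ℚₚ._≟_ ℚₚ._≟_

  crossingPairs : List (Pair n × Pair n)
  crossingPairs = filter alternatePairs? candidates

  -- Repetitions are removed among rational coordinates, where equality is decidable; embedding them
  -- in the plane afterwards is injective up to `_≈ₚ_`.
  intersections : List (ℚ × ℚ)
  intersections = deduplicate _≟ℚ²_ (map intersection crossingPairs)

  crossings : List Point
  crossings = map rationalPoint intersections

  ~-orient : ∀ e → IsEdge G e → proj₁ (orient e) ~ proj₂ (orient e)
  ~-orient e (_ , u~v) = [ (λ eq → subst (λ e → proj₁ e ~ proj₂ e) (sym eq) u~v) ,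
                           (λ eq → subst (λ e → proj₁ e ~ proj₂ e) (sym eq) (symm u~v)) ]′ (orient-cases e)

  orient-≡ : ∀ {u v} → rank u < rank v → orient (u , v) ≡ (u , v) × orient (v , u) ≡ (u , v)
  orient-≡ {u} {v} r = first , second
    where
    first : orient (u , v) ≡ (u , v)
    first with rank u ℕₚ.<? rank v
    ... | yes _ = refl
    ... | no r≮ = ⊥-elim (r≮ r)
    second : orient (v , u) ≡ (u , v)
    second with rank v ℕₚ.<? rank u
    ... | yes r′ = ⊥-elim (ℕₚ.<-asym r r′)
    ... | no _  = refl

  edge-oriented : ∀ {u v} → u ~ v → rank u < rank v → ∃ λ e → IsEdge G e × orient e ≡ (u , v)
  edge-oriented {u} {v} u~v r = by (Finₚ.<-cmp u v)
    where
    by : _ → ∃ λ e → IsEdge G e × orient e ≡ (u , v)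
    by (tri< u<v _ _)  = (u , v) , (u<v , u~v) , proj₁ (orient-≡ r)
    by (tri≈ _ refl _) = ⊥-elim (irrefl refl u~v)
    by (tri> _ _ v<u)  = (v , u) , (v<u , symm u~v) , proj₂ (orient-≡ r)

  ∈-edges : ∀ {e} → IsEdge G e → e ∈ edges
  ∈-edges {u , v} = ∈-filter⁺ (isEdge? G) (∈-cartesianProduct⁺ (∈-allFin u) (∈-allFin v))

  ∈-candidates⁺ : ∀ {a b} f → IsEdge G f → a ~ b → AlternatePairs (a , b) (orient f) →
    ((a , b) , orient f) ∈ candidates
  ∈-candidates⁺ {a} {b} f edge a~b alt = ∈-concatMap⁺ crossedBy (lose (∈-edges edge)
    (∈-concatMap⁺ (crossedFrom f) (lose (∈-elements (separates a~b (~-orient f edge) alt))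
      (∈-map⁺ (λ b → (a , b) , orient f) (∈-filter⁺ (a ~?_) (∈-allFin b) a~b)))))

  ∈-candidates⁻ : ∀ {e f} → (e , f) ∈ candidates →
    proj₁ e ~ proj₂ e × proj₁ f ~ proj₂ f
  ∈-candidates⁻ ef∈ =
    let (g , g∈ , h) = find (∈-concatMap⁻ crossedBy {xs = edges} ef∈)
        (a , a∈ , h′) = find (∈-concatMap⁻ (crossedFrom g) {xs = elements (separator (proj₁ (orient g)))} h)
        (b , b∈ , eq) = ∈-map⁻ _ h′
        (_ , edge) = ∈-filter⁻ (isEdge? G) {xs = cartesianProduct (allFin n) (allFin n)} g∈
        (_ , a~b) = ∈-filter⁻ (a ~?_) {xs = allFin n} b∈
    in subst (λ e → proj₁ e ~ proj₂ e) (sym (cong proj₁ eq)) a~b ,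
       subst (λ f → proj₁ f ~ proj₂ f) (sym (cong proj₂ eq)) (~-orient g edge)

  ∈-crossings : ∀ {P} e f → IsEdge G e → IsEdge G f → AlternatePairs (orient e) (orient f) →
    OnPair pos e P → OnPair pos f P → P ∈ₚ crossings
  ∈-crossings {P} e f edge edge′ alt on on′ = Anyₚ.map⁺ (lose
    (∈-deduplicate⁺ _≟ℚ²_ (∈-map⁺ intersection (∈-filter⁺ alternatePairs?
      (∈-candidates⁺ f edge′ (~-orient e edge) alt) alt)))
    (Alternating.crossing-unique
      (abscissa-mono-< (proj₁ alt)) (abscissa-mono-< (proj₁ (proj₂ alt))) (abscissa-mono-< (proj₂ (proj₂ alt)))
      (chord⊆line (orient-on e {P} on)) (chord⊆line (orient-on f {P} on′))))

  crossing-listed : ∀ P → IsCrossing P → P ∈ₚ crossings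
  crossing-listed P (e , f , edge , edge′ , e≢f , on , on′ , apart) =
    by (pairs-meet {P = P} (proj₁ edge) (proj₁ edge′) e≢f on on′)
    where
    by : _ → P ∈ₚ crossings
    by (inj₁ shared)     = ⊥-elim (apart shared)
    by (inj₂ (inj₁ alt)) = ∈-crossings {P} e f edge edge′ alt on on′
    by (inj₂ (inj₂ alt)) = ∈-crossings {P} f e edge′ edge alt on′ on

  alternate-disjoint : ∀ {e f w} → AlternatePairs e f → w ∈ₑ e → ¬ w ∈ₑ f
  alternate-disjoint (a<c , c<b , b<d) (inj₁ refl) (inj₁ refl) = ℕₚ.<-irrefl refl a<c
  alternate-disjoint (a<c , c<b , b<d) (inj₁ refl) (inj₂ refl) =
    ℕₚ.<-irrefl refl (ℕₚ.<-trans a<c (ℕₚ.<-trans c<b b<d))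
  alternate-disjoint (a<c , c<b , b<d) (inj₂ refl) (inj₁ refl) = ℕₚ.<-irrefl refl c<b
  alternate-disjoint (a<c , c<b , b<d) (inj₂ refl) (inj₂ refl) = ℕₚ.<-irrefl refl b<d

  ∈ₑ-orient : ∀ {w} e → w ∈ₑ e → w ∈ₑ orient e
  ∈ₑ-orient {w} e w∈ = [ (λ eq → subst (w ∈ₑ_) (sym eq) w∈) ,
                         (λ eq → subst (w ∈ₑ_) (sym eq) (∈ₑ-swap (swap e) w∈)) ]′ (orient-cases e)

  isCrossing : ∀ {e f P} → proj₁ e ~ proj₂ e → proj₁ f ~ proj₂ f → AlternatePairs e f →
    P ≈ₚ rationalPoint (intersection (e , f)) → IsCrossing P
  isCrossing {e} {f} {P} u~v w~z alt@(a<c , c<b , b<d) P≈X =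
    let (e′ , edge , eq)   = edge-oriented u~v (ℕₚ.<-trans a<c c<b)
        (f′ , edge′ , eq′) = edge-oriented w~z (ℕₚ.<-trans c<b b<d)
        disjoint : ∀ {w} → w ∈ₑ e′ → ¬ w ∈ₑ f′
        disjoint {w} w∈e w∈f = alternate-disjoint alt
          (subst (w ∈ₑ_) eq (∈ₑ-orient e′ w∈e)) (subst (w ∈ₑ_) eq′ (∈ₑ-orient f′ w∈f))
    in e′ , f′ , edge , edge′ ,
       (λ e≡f → disjoint (inj₁ refl) (subst (proj₁ e′ ∈ₑ_) e≡f (inj₁ refl))) ,
       onSegment-resp {pos (proj₁ e′)} {pos (proj₂ e′)} {P} {X} P≈X
         (orient-on⁻¹ e′ {X} (subst (λ e → OnOriented e X) (sym eq) crossing-on-first)) ,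
       onSegment-resp {pos (proj₁ f′)} {pos (proj₂ f′)} {P} {X} P≈X
         (orient-on⁻¹ f′ {X} (subst (λ e → OnOriented e X) (sym eq′) crossing-on-second)) ,
       (λ (w , w∈e , w∈f , _) → disjoint w∈e w∈f)
    where
    X = rationalPoint (intersection (e , f))
    open Alternating (abscissa-mono-< a<c) (abscissa-mono-< c<b) (abscissa-mono-< b<d)

  listed-crossing : ∀ P → P ∈ₚ crossings → IsCrossing P
  listed-crossing P P∈ =
    let (q , q∈ , P≈q) = find (Anyₚ.map⁻ P∈)
        (ef , ef∈ , q≡) = ∈-map⁻ intersection (∈-deduplicate⁻ _≟ℚ²_ _ q∈)
        (ef∈′ , alt) = ∈-filter⁻ alternatePairs? {xs = candidates} ef∈
        (u~v , w~z) = ∈-candidates⁻ ef∈′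
    in isCrossing {P = P} u~v w~z alt (subst (λ q → P ≈ₚ rationalPoint q) q≡ P≈q)

  rationalPoint-injective : ∀ {p q} → rationalPoint p ≈ₚ rationalPoint q → p ≡ q
  rationalPoint-injective (x≈ , y≈) = cong₂ _,_ (fromℚ-injective x≈) (fromℚ-injective y≈)

  crossings-unique : UniqueSetoid.Unique planeSetoid crossings
  crossings-unique = UniqueSetoidₚ.map⁺ (setoid (ℚ × ℚ)) planeSetoid rationalPoint-injective
    (UniqueDecₚ.deduplicate-! _≟ℚ²_ (map intersection crossingPairs))

  hasCrossings : HasCrossings (length crossings)
  hasCrossings = crossings , crossings-unique , (λ P → mk⇔ (crossing-listed P) (listed-crossing P)) , refl

  crossings-bound : ∀ {w} → (∀ v → ∣ separator v ∣ ≤ w) → length crossings ≤ ‖ G ‖ * (w * Δ G)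
  crossings-bound {w} small = begin
    length crossings                                     ≡⟨ Listₚ.length-map rationalPoint intersections ⟩
    length intersections                                 ≤⟨ length-deduplicate _≟ℚ²_ (map intersection crossingPairs) ⟩
    length (map intersection crossingPairs) ≡⟨ Listₚ.length-map intersection crossingPairs ⟩
    length crossingPairs           ≤⟨ Listₚ.length-filter alternatePairs? candidates ⟩
    length candidates                                    ≤⟨ length-concatMap edges crossedBy-bound ⟩
    ‖ G ‖ * (w * Δ G)                                    ∎
    where
    open ℕₚ.≤-Reasoning
    crossedFrom-bound : ∀ e a → length (crossedFrom e a) ≤ Δ G
    crossedFrom-bound e a = ℕₚ.≤-trans
      (ℕₚ.≤-reflexive (Listₚ.length-map _ (neighbours a))) (degree≤Δ G a)
    crossedBy-bound : ∀ e → length (crossedBy e) ≤ w * Δ G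
    crossedBy-bound e = ℕₚ.≤-trans
      (length-concatMap (elements (separator (proj₁ (orient e)))) (crossedFrom-bound e))
      (ℕₚ.*-monoˡ-≤ (Δ G) (ℕₚ.≤-trans (ℕₚ.≤-reflexive (length-elements (separator (proj₁ (orient e)))))
        (small (proj₁ (orient e)))))

-- The vertex order given by a tree decomposition

module DecompositionRanking {n} {G : Graph n} (D : TreeDecomposition G) where
  open Graph G
  open TreeDecomposition D
  private
    order = depthFirst T isTree
    L     = proj₁ order
    all∈L : ∀ s → s ∈ L
    all∈L = proj₂ (proj₂ order)
    open DepthFirst (proj₁ (proj₂ order)) using (o; separating)

  InBag : Fin n → Fin size → Set
  InBag v s = v ∈ₛ bag s

  first : Fin n → Fin size
  first v = argmin o (proj₁ (vertex-covered v)) (filter (λ s → v Subsetₚ.∈? bag s) (allFin size))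

  first-isFirst : ∀ v → IsFirst o (InBag v) (first v)
  first-isFirst v =
    argmin-all o {xs = filter inBag? (allFin size)} (proj₂ (vertex-covered v))
      (Allₚ.all-filter inBag? (allFin size)) ,
    λ s v∈s → All.lookup (f[argmin]≤f[xs] (proj₁ (vertex-covered v)) (filter inBag? (allFin size)))
      (∈-filter⁺ inBag? (∈-allFin s) v∈s)
    where
    inBag? : Decidable (InBag v)
    inBag? s = v Subsetₚ.∈? bag s

  -- Lexicographic order by first node and then by index, as a two-digit number: `toℕ v < n` keeps
  -- the second digit from carrying.
  rank : Fin n → ℕ
  rank v = o (first v) * n + toℕ v

  first-<⇒rank-< : ∀ {u v} → o (first u) < o (first v) → rank u < rank v
  first-<⇒rank-< {u} {v} u<v = begin-strict
    o (first u) * n + toℕ u  <⟨ ℕₚ.+-monoʳ-< (o (first u) * n) (Finₚ.toℕ<n u) ⟩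
    o (first u) * n + n      ≡⟨ ℕₚ.+-comm (o (first u) * n) n ⟩
    suc (o (first u)) * n    ≤⟨ ℕₚ.*-monoˡ-≤ n u<v ⟩
    o (first v) * n          ≤⟨ ℕₚ.m≤m+n _ (toℕ v) ⟩
    rank v                   ∎
    where open ℕₚ.≤-Reasoning

  rank-<⇒first-≤ : ∀ {u v} → rank u < rank v → o (first u) ≤ o (first v)
  rank-<⇒first-≤ {u} {v} u<v = ℕₚ.≮⇒≥ λ v<u → ℕₚ.<-asym u<v (first-<⇒rank-< {v} {u} v<u)

  rank-injective : ∀ {u v} → rank u ≡ rank v → u ≡ v
  rank-injective {u} {v} eq = by (ℕₚ.<-cmp (o (first u)) (o (first v)))
    where
    by : _ → u ≡ v
    by (tri< u<v _ _) = ⊥-elim (ℕₚ.<⇒≢ (first-<⇒rank-< {u} {v} u<v) eq)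
    by (tri≈ _ u≡v _) = Finₚ.toℕ-injective (ℕₚ.+-cancelˡ-≡ (o (first v) * n) (toℕ u) (toℕ v)
      (subst (λ k → k * n + toℕ u ≡ rank v) u≡v eq))
    by (tri> _ _ v<u) = ⊥-elim (ℕₚ.<⇒≢ (first-<⇒rank-< {v} {u} v<u) (sym eq))

  -- The nodes whose bags contain a given vertex are the connected sets of `Separating`, and those
  -- of adjacent vertices meet by `edge-covered`. Vertices may share a first node, so the ranks
  -- yield only weak inequalities between first nodes, which is all that `Separating` asks for.
  separates : ∀ {a b c d} → a ~ b → c ~ d →
    Alternate (rank a) (rank b) (rank c) (rank d) → a ∈ₛ bag (first c)
  separates {a} {b} {c} {d} a~b c~d (a<c , c<b , b<d) =
    separating {Y = InBag a} {X = InBag b} {Q = InBag c} {V = InBag d}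
      (λ {s} _ → all∈L s) (λ {s} _ → all∈L s) (λ {s} _ → all∈L s) (λ {s} _ → all∈L s)
      (connected a) (connected b) (connected c) (connected d)
      (first-isFirst a) (first-isFirst b) (first-isFirst c) (first-isFirst d)
      (edge-covered a b a~b) (edge-covered c d c~d)
      (rank-<⇒first-≤ {a} {c} a<c) (rank-<⇒first-≤ {c} {b} c<b) (rank-<⇒first-≤ {b} {d} b<d)

  bag-size : ∀ s → ∣ bag s ∣ ≤ suc width
  bag-size s = ℕₚ.≤-trans
    (All.lookup (xs≤max 0 sizes) (∈-map⁺ (λ s → ∣ bag s ∣) (∈-allFin s)))
    -- The subtraction in `width` is truncated; the inequality survives when all bags are empty.
    (ℕₚ.m≤n+m∸n (max 0 sizes) 1)
    where
    sizes = map (λ s → ∣ bag s ∣) (allFin size)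

theorem19 : (k : ℕ) → 1 ≤ k → ∀ {n} (G : Graph n) →
    TreewidthAtMost G k →
    RectilinearCrossingNumberAtMost G (k * (k + 2) * Δ G * ‖ G ‖)
theorem19 k 1≤k G (w , (D , refl) , w≤k) =
  length crossings , (drawing G , hasCrossings) , (begin
    length crossings                 ≤⟨ crossings-bound (λ v → ℕₚ.≤-trans (bag-size (first v)) (s≤s w≤k)) ⟩
    ‖ G ‖ * (suc k * Δ G)            ≡⟨ ℕₚ.*-comm ‖ G ‖ (suc k * Δ G) ⟩
    suc k * Δ G * ‖ G ‖              ≤⟨ ℕₚ.*-monoˡ-≤ ‖ G ‖ (ℕₚ.*-monoˡ-≤ (Δ G) suc-k≤) ⟩
    k * (k + 2) * Δ G * ‖ G ‖        ∎)
  where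
  open DecompositionRanking D
  open ParabolaDrawing rank rank-injective using (drawing)
  open SeparatedRanking G rank rank-injective (λ c → TreeDecomposition.bag D (first c))
    (λ {a} {b} {c} {d} → separates {a} {b} {c} {d})
  open ℕₚ.≤-Reasoning
  -- This is where `1≤k` enters: at `k = 0` the right-hand side would be 0, while a bag may have one
  -- element.
  suc-k≤ : suc k ≤ k * (k + 2)
  suc-k≤ = begin
    suc k        ≡⟨ ℕₚ.+-comm 1 k ⟩
    k + 1        ≤⟨ ℕₚ.+-monoʳ-≤ k (s≤s z≤n) ⟩
    k + 2        ≡⟨ ℕₚ.*-identityˡ (k + 2) ⟨
    1 * (k + 2)  ≤⟨ ℕₚ.*-monoˡ-≤ (k + 2) 1≤k ⟩
    k * (k + 2)  ∎
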